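{- Assume the ABC Conjecture holds in $\mathbb{Z}$. Let $N>0$ be an integer and let $E_N$ be the elliptic curve $y^2=x^3-Nx$ over $\mathbb{Q}$. Let $Q_1\in E_N(\mathbb{Q})$ be a non-torsion point with $x(Q_1)<0$. (1) There is a constant $c>0$, independent of $N$, $Q_1$ and $n$, such that for every integer $n$ with $nQ_1\neq O$ and $L(nQ_1)\le 1$ we have $h_O(nQ_1)\le c\log N$. (2) Let moreover $Q_2\in E_N(\mathbb{Q})$ be a point such that $Q_1,Q_2$ are independent, and such that either $Q_2=2R$ for some $R\in E_N(\mathbb{Q})$, or $x(Q_2)$ is the square of a rational number. Let $G=\langle Q_1,Q_2\rangle\subseteq E_N(\mathbb{Q})$. Then there is a constant $c>0$, independent of $N$ and of the points, such that every $Q\in G$ with $Q\ne O$ and $L(Q)\le 1$ satisfies $h_O(Q)\le c\log N$.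
   Context: $O$ denotes the point at infinity of $E_N$. For a non-identity rational point $Q$, the length $L(Q)$ is the number of distinct primes $p$ with $|x(Q)|_p>1$ (equivalently, writing $x(Q)=A/B^2$ in lowest terms, the number of distinct prime divisors of $B$). The height from $O$ is $h_O(Q)=\max\{0,\log|x(Q)|\}$. The statement "$h_O(Q)\ll\log N$" in the paper means a uniform bound with implied constant independent of $N$ and $Q$. -}

module Defs where

open import Data.Nat as ℕ using (ℕ; zero; suc)
open import Data.Nat.Divisibility using (_∣_; _∣?_)
open import Data.Nat.Primality using (Prime; prime?)
open import Data.Nat.Coprimality using (Coprime)
open import Data.Integer as ℤ using (ℤ; +_; -[1+_])
open import Data.Rational as ℚ using (ℚ; 0ℚ; 1ℚ; _+_; _*_; _-_; -_; 1/_; ≢-nonZero; ∣_∣)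
open import Data.Rational.Properties using (_≟_)
open import Data.List using (List; length; filter; upTo)
open import Data.Nat.ListAction using (product)
open import Data.Product using (_×_; _,_; Σ)
open import Relation.Nullary using (yes; no; ¬_)
open import Relation.Nullary.Decidable using (_×-dec_)
open import Relation.Binary.PropositionalEquality using (_≡_; _≢_)

_^ℚ_ : ℚ → ℕ → ℚ
q ^ℚ zero  = 1ℚ
q ^ℚ suc n = q * (q ^ℚ n)

ℕ→ℚ : ℕ → ℚ
ℕ→ℚ n = (+ n) ℚ./ 1

-- total inverse (only ever applied to nonzero arguments below)
inv : ℚ → ℚ
inv q with q ≟ 0ℚ
... | yes _  = 0ℚ
... | no q≢0 = 1/_ q {{≢-nonZero q≢0}}

-- the distinct primes dividing n (all of them are ≤ n for n ≥ 1)
primeDivisors : ℕ → List ℕ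
primeDivisors n = filter (λ p → prime? p ×-dec p ∣? n) (upTo (suc n))

rad : ℕ → ℕ
rad n = product (primeDivisors n)

-- ABC conjecture (over ℤ, stated for positive coprime a + b = c;
-- ε = e/d > 0 rational, constant K a positive natural number):
--   c ≤ K · rad(abc)^(1+ε)   ⟺   c^d ≤ K^d · rad(abc)^(d+e)

ABC : Set
ABC = (e d : ℕ) → 1 ℕ.≤ e → 1 ℕ.≤ d →
      Σ ℕ λ K → 1 ℕ.≤ K ×
        ((a b c : ℕ) → 1 ℕ.≤ a → 1 ℕ.≤ b → Coprime a b → a ℕ.+ b ≡ c →
          c ℕ.^ d ℕ.≤ (K ℕ.^ d) ℕ.* (rad (a ℕ.* b ℕ.* c) ℕ.^ (d ℕ.+ e)))

data Pt : Set where
  O  : Pt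
  af : ℚ → ℚ → Pt

OnCurve : ℕ → Pt → Set
OnCurve N O        = Data.Unit.⊤ where import Data.Unit
OnCurve N (af x y) = y * y ≡ x * x * x - ℕ→ℚ N * x

-- chord-and-tangent group law on E_N (a = -N, b = 0)
neg : Pt → Pt
neg O        = O
neg (af x y) = af x (- y)

add : ℕ → Pt → Pt → Pt
add N O Q = Q
add N P O = P
add N (af x₁ y₁) (af x₂ y₂) with x₁ ≟ x₂
... | no _ =
  let l  = (y₂ - y₁) * inv (x₂ - x₁)
      x₃ = l * l - x₁ - x₂
  in af x₃ (l * (x₁ - x₃) - y₁)
... | yes _ with y₁ ≟ (- y₂)
...   | yes _ = O
...   | no _  =
  let l  = (ℕ→ℚ 3 * x₁ * x₁ - ℕ→ℚ N) * inv (ℕ→ℚ 2 * y₁)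
      x₃ = l * l - x₁ - x₂
  in af x₃ (l * (x₁ - x₃) - y₁)

mulℕ : ℕ → ℕ → Pt → Pt
mulℕ N zero    P = O
mulℕ N (suc k) P = add N P (mulℕ N k P)

mul : ℕ → ℤ → Pt → Pt
mul N (+ k)      P = mulℕ N k P
mul N -[1+ k ]   P = neg (mulℕ N (suc k) P)

NonTorsion : ℕ → Pt → Set
NonTorsion N P = (m : ℕ) → 1 ℕ.≤ m → mulℕ N m P ≢ O

Independent : ℕ → Pt → Pt → Set
Independent N P Q = (a b : ℤ) → add N (mul N a P) (mul N b Q) ≡ O → (a ≡ + 0) × (b ≡ + 0)

InSpan : ℕ → Pt → Pt → Pt → Set
InSpan N P₁ P₂ Q = Σ ℤ λ a → Σ ℤ λ b → Q ≡ add N (mul N a P₁) (mul N b P₂)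

-- x-coordinate (O has none; value irrelevant where used)
xc : Pt → ℚ
xc O        = 0ℚ
xc (af x _) = x

-- L(Q): number of distinct primes dividing the denominator of x(Q)
-- (same primes as those dividing B when x(Q) = A/B² in lowest terms)
L : Pt → ℕ
L Q = length (primeDivisors (ℚ.denominatorℕ (xc Q)))

-- h_O(Q) ≤ c log N with c = p/q > 0:
--   max(0, log|x|) ≤ (p/q) log N  ⟺  |x|^q ≤ N^p   (as N ≥ 1)
HeightBound : ℕ → ℕ → ℕ → Pt → Set
HeightBound p q N Q = (∣ xc Q ∣ ^ℚ q) ℚ.≤ (ℕ→ℚ N ^ℚ p)

XSquare : Pt → Set
XSquare Q = Σ ℚ λ r → xc Q ≡ r * r

IsDouble : ℕ → Pt → Set
IsDouble N Q = Σ Pt λ R → OnCurve N R × (Q ≡ add N R R)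

{-# OPTIONS --safe #-}
module Submission where

-- The map α : x ↦ x mod squares (with O ↦ 1 and (0,0) ↦ −N) satisfies α(P)α(Q)α(P+Q) = 1 in ℚ*/ℚ*²,
-- because a line y = lx + m meets E_N in points with x₁x₂x₃ = m².  As α(Q₂) = 1, every Q in the span
-- has α(Q) = 1 or α(Q) = α(Q₁).  In the second case x(Q) ≤ 0, so Q lies on the compact component and
-- x(Q)² ≤ N.  In the first case x(Q) = (u/B)² and u⁴ − v² = N B⁴ for some v.  When B has at most one
-- prime factor, one of u² ± v divides 2N, say 2N = d f, whence 2d + f B⁴ = 4u²; ABC with ε = 1/4
-- applied to this equation bounds u by a power of N times a constant.  The constant is absorbed when
-- N ≥ 2, and for N = 1 Fermat's theorem on u⁴ − v² = B⁴ gives x(Q) = 1.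

open import Defs
open import Data.Empty using (⊥; ⊥-elim)
open import Data.Nat using (ℕ)
open import Data.Nat.Coprimality as Co using (Coprime; coprime-divisor; gcd≡1⇒coprime)
open import Data.Nat.Divisibility
open import Data.Nat.Primality
open import Data.Integer using (ℤ)
open import Data.Product using (Σ; ∃-syntax; _×_; _,_; proj₁; proj₂)
open import Data.Sum using (_⊎_; inj₁; inj₂; [_,_]′)
open import Relation.Nullary using (Dec; ¬_; yes; no; contradiction)
open import Relation.Nullary.Decidable using (_×-dec_)
open import Relation.Binary.PropositionalEquality using (_≡_; _≢_; refl; sym; trans; cong; cong₂; subst; subst₂; module ≡-Reasoning)

-- The choice ε = 1/4 comes from an exponent count. In 2d + f B⁴ = 4u² the radical sees B⁴ only as
-- B, and B² ≤ 2u, so the radical is at most a constant times N u^(3/2). Removing the common factor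
-- of the terms, which is at most 4N, leaves a largest term of at least u²/N. So u is bounded as
-- soon as (3/2)(1 + ε) < 2, that is ε < 1/3; for ε = 1/4 the comparison, cleared of fractions, is
-- u^16 against u^15. The hypothesis L(Q) ≤ 1 keeps B⁴ in one piece: with two primes in B, the
-- factors u² + v and u² - v could share B⁴ between them, and neither would have to divide 2N. In
-- the class of Q₁ only signs matter: x(Q₁) x(Q) is a square and x(Q₁) < 0, which forces x(Q) ≤ 0.

module Arithmetic where
  open import Data.List using ([]; _∷_; upTo)
  open import Data.List.Relation.Unary.All as All using (All; []; _∷_)
  open import Data.List.Relation.Unary.All.Properties using (all-filter)
  open import Data.List.Relation.Unary.AllPairs using ([]; _∷_)
  open import Data.List.Relation.Unary.Unique.Propositional using (Unique)
  open import Data.List.Relation.Unary.Unique.Propositional.Properties using (filter⁺; upTo⁺)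
  open import Data.Nat
  open import Data.Nat.GCD
  open import Data.Nat.Induction using (<-rec)
  open import Data.Nat.ListAction using (product)
  open import Data.Nat.Primality.Factorisation using (factorise)
  open import Data.Nat.Properties
  open import Data.Nat.Tactic.RingSolver using (solve-∀)

  -- Coprimality tested on common primes, and coprime factors of a square.

  ∣-respʳ-≡ : ∀ {d m n} → m ≡ n → d ∣ m → d ∣ n
  ∣-respʳ-≡ refl d∣m = d∣m

  ∃-primeDivisor : ∀ n → .{{NonZero n}} → n ≢ 1 → ∃[ p ] Prime p × p ∣ n
  ∃-primeDivisor n n≢1 with factorise n
  ... | record { factors = []     ; isFactorisation = n≡1 } = contradiction n≡1 n≢1
  ... | record { factors = p ∷ ps ; isFactorisation = n≡ps ; factorsPrime = pp ∷ _ } =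
    p , pp , ∣-respʳ-≡ (sym n≡ps) (m∣m*n _)

  coprime⊎commonPrime : ∀ m n → .{{NonZero n}} → Coprime m n ⊎ (∃[ p ] Prime p × p ∣ m × p ∣ n)
  coprime⊎commonPrime m n with gcd m n ≟ 1
  ... | yes g≡1 = inj₁ (gcd≡1⇒coprime g≡1)
  ... | no  g≢1 with ∃-primeDivisor (gcd m n) {{≢-nonZero (gcd[m,n]≢0 m n (inj₂ (≢-nonZero⁻¹ n)))}} g≢1
  ...   | p , pp , p∣g =
    inj₂ (p , pp , ∣-trans p∣g (gcd[m,n]∣m m n) , ∣-trans p∣g (gcd[m,n]∣n m n))

  noCommonPrime⇒coprime : ∀ m n → .{{NonZero n}} → (∀ {p} → Prime p → p ∣ m → p ∣ n → ⊥) → Coprime m n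
  noCommonPrime⇒coprime m n h with coprime⊎commonPrime m n
  ... | inj₁ c = c
  ... | inj₂ (p , pp , p∣m , p∣n) = ⊥-elim (h pp p∣m p∣n)

  coprime⇒noCommonPrime : ∀ {m n p} → Coprime m n → Prime p → p ∣ m → p ∣ n → ⊥
  coprime⇒noCommonPrime c pp p∣m p∣n = ¬prime[1] (subst Prime (c (p∣m , p∣n)) pp)

  prime∣m²⇒∣m : ∀ {p} m → Prime p → p ∣ m * m → p ∣ m
  prime∣m²⇒∣m m pp p∣m² = [ (λ z → z) , (λ z → z) ]′ (euclidsLemma m m pp p∣m²)

  prime∣prime⇒≡ : ∀ {p q} → Prime p → Prime q → p ∣ q → p ≡ q
  prime∣prime⇒≡ pp qp p∣q with prime⇒irreducible qp p∣q
  ... | inj₁ refl = contradiction pp ¬prime[1]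
  ... | inj₂ p≡q  = p≡q

  coprime-squareˡ : ∀ {m n} → .{{NonZero n}} → Coprime m n → Coprime (m * m) n
  coprime-squareˡ {m} {n} c = noCommonPrime⇒coprime (m * m) n λ pp p∣m² →
    coprime⇒noCommonPrime c pp (prime∣m²⇒∣m m pp p∣m²)

  coprime-squareʳ : ∀ {m n} → .{{NonZero n}} → Coprime m n → Coprime m (n * n)
  coprime-squareʳ {m} {n} cop = noCommonPrime⇒coprime m (n * n) {{m*n≢0 n n}} λ pp p∣m p∣n² →
    coprime⇒noCommonPrime cop pp p∣m (prime∣m²⇒∣m n pp p∣n²)

  -- gcd(a,c)² = gcd(a², ac, c²) = gcd(a², ac, ab) = a gcd(a, c, b) = a.
  coprime-product-square : ∀ a b c → Coprime a b → a * b ≡ c * c → ∃[ d ] a ≡ d * d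
  coprime-product-square a b c cop ab≡cc = g , sym (begin
    g * g                                                ≡⟨ c*gcd[m,n]≡gcd[cm,cn] g a c ⟩
    gcd (g * a) (g * c)                                  ≡⟨ cong₂ gcd (trans (*-comm g a) (c*gcd[m,n]≡gcd[cm,cn] a a c)) (trans (*-comm g c) (c*gcd[m,n]≡gcd[cm,cn] c a c)) ⟩
    gcd (gcd (a * a) (a * c)) (gcd (c * a) (c * c))      ≡⟨ cong₂ (λ s t → gcd (gcd (a * a) (a * c)) (gcd s t)) (*-comm c a) (sym ab≡cc) ⟩
    gcd (gcd (a * a) (a * c)) (gcd (a * c) (a * b))      ≡⟨ cong₂ gcd (sym (c*gcd[m,n]≡gcd[cm,cn] a a c)) (sym (c*gcd[m,n]≡gcd[cm,cn] a c b)) ⟩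
    gcd (a * gcd a c) (a * gcd c b)                      ≡⟨ sym (c*gcd[m,n]≡gcd[cm,cn] a (gcd a c) (gcd c b)) ⟩
    a * gcd (gcd a c) (gcd c b)                          ≡⟨ cong (a *_) (cop (∣-trans (gcd[m,n]∣m _ _) (gcd[m,n]∣m a c) , ∣-trans (gcd[m,n]∣n (gcd a c) _) (gcd[m,n]∣n c b))) ⟩
    a * 1                                                ≡⟨ *-identityʳ a ⟩
    a                                                    ∎)
    where
    open ≡-Reasoning
    g = gcd a c

  coprime-product-squares : ∀ a b c → Coprime a b → a * b ≡ c * c → (∃[ d ] a ≡ d * d) × (∃[ e ] b ≡ e * e)
  coprime-product-squares a b c cop ab≡cc =
    coprime-product-square a b c cop ab≡cc ,
    coprime-product-square b a c (Co.sym cop) (trans (*-comm b a) ab≡cc)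

  m²≤n²⇒m≤n : ∀ {m n} → m * m ≤ n * n → m ≤ n
  m²≤n²⇒m≤n {m} {n} le with m ≤? n
  ... | yes m≤n = m≤n
  ... | no  m≰n = contradiction (*-mono-< (≰⇒> m≰n) (≰⇒> m≰n)) (≤⇒≯ le)

  1≤m²⇒1≤m : ∀ {m} → 1 ≤ m * m → 1 ≤ m
  1≤m²⇒1≤m {suc m} _ = s≤s z≤n

  1≤m*n⇒1≤m : ∀ m n → 1 ≤ m * n → 1 ≤ m
  1≤m*n⇒1≤m (suc m) n _ = s≤s z≤n

  1≤m*n⇒1≤n : ∀ m n → 1 ≤ m * n → 1 ≤ n
  1≤m*n⇒1≤n m n le = 1≤m*n⇒1≤m n m (subst (1 ≤_) (*-comm m n) le)

  -- Fermat's descent: no square is the common difference of three squares in progression.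

  a²+2ta+t²≡[a+t]² : ∀ a t → a * a + (2 * (t * a) + t * t) ≡ (a + t) * (a + t)
  a²+2ta+t²≡[a+t]² = solve-∀

  2·2s[a+s]≡2·2sa+[2s]² : ∀ a s → 2 * (2 * (s * (a + s))) ≡ 2 * (2 * s * a) + 2 * s * (2 * s)
  2·2s[a+s]≡2·2sa+[2s]² = solve-∀

  -- The gap t = b - a satisfies t² = 2(e - ta), so it is even. With s = t/2, the numbers s and a +
  -- s are the half-difference and the half-sum of a and b.
  even-difference-of-squares : ∀ a b e → a * a + 2 * e ≡ b * b → ∃[ s ] b ≡ a + 2 * s × 2 * (s * (a + s)) ≡ e
  even-difference-of-squares a b e eq = halve (prime∣m²⇒∣m t prime[2] 2∣t²)
    where
    a≤b : a ≤ b
    a≤b = m²≤n²⇒m≤n (≤-trans (m≤m+n (a * a) (2 * e)) (≤-reflexive eq))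
    t = b ∸ a
    b≡a+t : b ≡ a + t
    b≡a+t = sym (m+[n∸m]≡n a≤b)
    difference : 2 * (t * a) + t * t ≡ 2 * e
    difference = +-cancelˡ-≡ (a * a) _ _ (begin
      a * a + (2 * (t * a) + t * t) ≡⟨ a²+2ta+t²≡[a+t]² a t ⟩
      (a + t) * (a + t)             ≡⟨ cong₂ _*_ (sym b≡a+t) (sym b≡a+t) ⟩
      b * b                         ≡⟨ sym eq ⟩
      a * a + 2 * e                 ∎)
      where open ≡-Reasoning
    2∣t² : 2 ∣ t * t
    2∣t² = ∣m+n∣m⇒∣n (∣-respʳ-≡ (sym difference) (m∣m*n e)) (m∣m*n (t * a))
    halve : 2 ∣ t → ∃[ s ] b ≡ a + 2 * s × 2 * (s * (a + s)) ≡ e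
    halve (divides s t≡s*2) = s , trans b≡a+t (cong (a +_) t≡2s) , *-cancelˡ-≡ _ _ 2 (trans (2·2s[a+s]≡2·2sa+[2s]² a s) (subst (λ t → 2 * (t * a) + t * t ≡ 2 * e) t≡2s difference))
      where
      t≡2s : t ≡ 2 * s
      t≡2s = trans t≡s*2 (*-comm s 2)

  -- The squares d², P², c² are in arithmetic progression with common difference Q². That this is
  -- impossible amounts to 1 not being a congruent number.
  Congruum : ℕ → ℕ → Set
  Congruum P Q = Coprime P Q × 1 ≤ Q × (∃[ c ] P * P + Q * Q ≡ c * c) × (∃[ d ] d * d + Q * Q ≡ P * P)

  n+n+h≡h+2n : ∀ n h → n + n + h ≡ h + 2 * n
  n+n+h≡h+2n = solve-∀

  -- For m = n + h the two numbers are m - n and m + n. A common prime divides 2n; it is odd because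
  -- h is, so it divides n, and then m as well.
  coprime-factors-of-difference : ∀ n h → 1 ≤ n → ¬ 2 ∣ h → Coprime (n + h) n → Coprime h (n + n + h)
  coprime-factors-of-difference n h 1≤n 2∤h cop =
    noCommonPrime⇒coprime h (n + n + h) {{>-nonZero (≤-trans 1≤n (≤-trans (m≤m+n n n) (m≤m+n _ h)))}} λ {p} pp p∣h p∣e →
    let p∣2n = ∣m+n∣m⇒∣n (∣-respʳ-≡ (n+n+h≡h+2n n h) p∣e) p∣h
    in [ (λ p∣2 → 2∤h (subst (_∣ h) (prime∣prime⇒≡ pp prime[2] p∣2) p∣h))
       , (λ p∣n → coprime⇒noCommonPrime cop pp (∣m∣n⇒∣m+n p∣n p∣h) p∣n) ]′ (euclidsLemma 2 n pp p∣2n)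

  m²≡n²⇒m≡n : ∀ m n → m * m ≡ n * n → m ≡ n
  m²≡n²⇒m≡n m n eq = ≤-antisym (m²≤n²⇒m≤n (≤-reflexive eq)) (m²≤n²⇒m≤n (≤-reflexive (sym eq)))

  n²m²≡[mn]² : ∀ n m → n * n * (m * m) ≡ (m * n) * (m * n)
  n²m²≡[mn]² = solve-∀

  s+2j≡s+j+j : ∀ s j → s + 2 * j ≡ (s + j) + j
  s+2j≡s+j+j = solve-∀

  -- Euclid's parametrisation for the legs s and 2k: k² is the product of (P - s)/2 and (P + s)/2,
  -- which are coprime and hence squares n² and m².
  primitive-right-triangle : ∀ k s P → 1 ≤ k → Coprime (2 * k) s → s * s + 2 * (2 * (k * k)) ≡ P * P →
    ∃[ m ] ∃[ n ] Coprime m n × k ≡ m * n × s + n * n ≡ m * m × P ≡ m * m + n * n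
  primitive-right-triangle k s P 1≤k cop eq = parametrise (even-difference-of-squares s P (2 * (k * k)) eq)
    where
    1≤k² : 1 ≤ k * k
    1≤k² = *-mono-≤ 1≤k 1≤k
    parametrise : (∃[ j ] P ≡ s + 2 * j × 2 * (j * (s + j)) ≡ 2 * (k * k)) →
      ∃[ m ] ∃[ n ] Coprime m n × k ≡ m * n × s + n * n ≡ m * m × P ≡ m * m + n * n
    parametrise (j , P≡ , jeq) = extract (coprime-product-squares j (s + j) k cop-j product≡)
      where
      product≡ : j * (s + j) ≡ k * k
      product≡ = *-cancelˡ-≡ _ _ 2 jeq
      cop-j : Coprime j (s + j)
      cop-j = noCommonPrime⇒coprime j (s + j) {{>-nonZero (1≤m*n⇒1≤n j (s + j) (subst (1 ≤_) (sym product≡) 1≤k²))}} λ {p} pp p∣j p∣s+j →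
        coprime⇒noCommonPrime cop pp
          (∣n⇒∣m*n 2 (prime∣m²⇒∣m k pp (∣-respʳ-≡ product≡ (∣m⇒∣m*n (s + j) p∣j))))
          (∣m+n∣m⇒∣n (∣-respʳ-≡ (+-comm s j) p∣s+j) p∣j)
      extract : (∃[ n ] j ≡ n * n) × (∃[ m ] s + j ≡ m * m) →
        ∃[ m ] ∃[ n ] Coprime m n × k ≡ m * n × s + n * n ≡ m * m × P ≡ m * m + n * n
      extract ((n , refl) , (m , s+j≡m²)) =
        m , n ,
        (λ (d∣m , d∣n) → cop-j (∣m⇒∣m*n n d∣n , ∣-respʳ-≡ (sym s+j≡m²) (∣m⇒∣m*n m d∣m))) ,
        m²≡n²⇒m≡n k (m * n) (trans (sym product≡) (trans (cong (n * n *_) s+j≡m²) (n²m²≡[mn]² n m))) ,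
        s+j≡m² ,
        trans P≡ (trans (s+2j≡s+j+j s (n * n)) (cong (_+ n * n) s+j≡m²))

  [n+h]²≡h[2n+h]+n² : ∀ n h → (n + h) * (n + h) ≡ h * (n + n + h) + n * n
  [n+h]²≡h[2n+h]+n² = solve-∀

  n+h+n≡n+n+h : ∀ n h → n + h + n ≡ n + n + h
  n+h+n≡n+n+h = solve-∀

  -- The even leg 2k and the odd leg s of a primitive right triangle whose area ks is a square
  -- are 2mn and m² − n², and m = P′², n = Q′² is again a congruum.
  triangle⇒congruum : ∀ k s P q → 1 ≤ k → Coprime (2 * k) s → s * s + 2 * (2 * (k * k)) ≡ P * P → k * s ≡ q * q →
                      ∃[ P′ ] ∃[ Q′ ] Congruum P′ Q′ × P′ < P
  triangle⇒congruum k s P q 1≤k cop eq ks≡qq =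
    fromSquares (primitive-right-triangle k s P 1≤k cop eq)
                (coprime-product-squares k s q (λ (d∣k , d∣s) → cop (∣n⇒∣m*n 2 d∣k , d∣s)) ks≡qq)
    where
    fromSquares : (∃[ m ] ∃[ n ] Coprime m n × k ≡ m * n × s + n * n ≡ m * m × P ≡ m * m + n * n) →
                  (∃[ e ] k ≡ e * e) × (∃[ f ] s ≡ f * f) → ∃[ P′ ] ∃[ Q′ ] Congruum P′ Q′ × P′ < P
    fromSquares (m , n , cop-mn , k≡mn , s+n²≡m² , P≡m²+n²) ((e , k≡e²) , (f , s≡f²)) =
      fromDifference (m≤n⇒∃[o]m+o≡n (m²≤n²⇒m≤n (subst (n * n ≤_) s+n²≡m² (m≤n+m (n * n) s))))
      where
      1≤mn : 1 ≤ m * n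
      1≤mn = subst (1 ≤_) k≡mn 1≤k
      1≤m : 1 ≤ m
      1≤m = 1≤m*n⇒1≤m m n 1≤mn
      1≤n : 1 ≤ n
      1≤n = 1≤m*n⇒1≤n m n 1≤mn
      fromDifference : (∃[ h ] n + h ≡ m) → ∃[ P′ ] ∃[ Q′ ] Congruum P′ Q′ × P′ < P
      fromDifference (h , n+h≡m) =
        conclude (coprime-product-squares m n e cop-mn (trans (sym k≡mn) k≡e²))
                 (coprime-product-squares h (n + n + h) f cop-h (trans (sym s≡h[2n+h]) s≡f²))
        where
        s≡h[2n+h] : s ≡ h * (n + n + h)
        s≡h[2n+h] = +-cancelʳ-≡ (n * n) _ _ (trans s+n²≡m² (trans (cong₂ _*_ (sym n+h≡m) (sym n+h≡m)) ([n+h]²≡h[2n+h]+n² n h)))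
        2∤h : ¬ 2 ∣ h
        2∤h 2∣h = coprime⇒noCommonPrime cop prime[2] (m∣m*n k) (∣-respʳ-≡ (sym s≡h[2n+h]) (∣m⇒∣m*n (n + n + h) 2∣h))
        cop-h : Coprime h (n + n + h)
        cop-h = coprime-factors-of-difference n h 1≤n 2∤h (subst (λ m → Coprime m n) (sym n+h≡m) cop-mn)
        conclude : (∃[ P′ ] m ≡ P′ * P′) × (∃[ Q′ ] n ≡ Q′ * Q′) → (∃[ d ] h ≡ d * d) × (∃[ c ] n + n + h ≡ c * c) →
                   ∃[ P′ ] ∃[ Q′ ] Congruum P′ Q′ × P′ < P
        conclude ((P′ , m≡P′²) , (Q′ , n≡Q′²)) ((d , h≡d²) , (c , e≡c²)) =
          P′ , Q′ , (cop′ , 1≤m²⇒1≤m (subst (1 ≤_) n≡Q′² 1≤n) , (c , sum) , (d , difference)) , P′<P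
          where
          cop′ : Coprime P′ Q′
          cop′ (x∣P′ , x∣Q′) = cop-mn (∣-respʳ-≡ (sym m≡P′²) (∣m⇒∣m*n P′ x∣P′) , ∣-respʳ-≡ (sym n≡Q′²) (∣m⇒∣m*n Q′ x∣Q′))
          sum : P′ * P′ + Q′ * Q′ ≡ c * c
          sum = begin
            P′ * P′ + Q′ * Q′ ≡⟨ cong₂ _+_ (sym m≡P′²) (sym n≡Q′²) ⟩
            m + n             ≡⟨ cong (_+ n) (sym n+h≡m) ⟩
            n + h + n         ≡⟨ n+h+n≡n+n+h n h ⟩
            n + n + h         ≡⟨ e≡c² ⟩
            c * c             ∎
            where open ≡-Reasoning
          difference : d * d + Q′ * Q′ ≡ P′ * P′
          difference = begin
            d * d + Q′ * Q′ ≡⟨ cong₂ _+_ (sym h≡d²) (sym n≡Q′²) ⟩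
            h + n           ≡⟨ +-comm h n ⟩
            n + h           ≡⟨ n+h≡m ⟩
            m               ≡⟨ m≡P′² ⟩
            P′ * P′         ∎
            where open ≡-Reasoning
          1≤P′ : 1 ≤ P′
          1≤P′ = 1≤m²⇒1≤m (subst (1 ≤_) m≡P′² 1≤m)
          P′<P : P′ < P
          P′<P = begin-strict
            P′            ≤⟨ m≤m*n P′ P′ {{>-nonZero 1≤P′}} ⟩
            P′ * P′       ≡⟨ sym m≡P′² ⟩
            m             ≤⟨ m≤m*n m m {{>-nonZero 1≤m}} ⟩
            m * m         <⟨ m<m+n (m * m) (*-mono-≤ 1≤n 1≤n) ⟩
            m * m + n * n ≡⟨ sym P≡m²+n² ⟩
            P             ∎
            where open ≤-Reasoning

  y²+4k²≡[2k]²+y² : ∀ k y → y * y + 2 * (2 * (k * k)) ≡ 2 * k * (2 * k) + y * y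
  y²+4k²≡[2k]²+y² = solve-∀

  evenLeg⇒congruum : ∀ x y P q → 1 ≤ x → Coprime x y → x * x + y * y ≡ P * P → x * y ≡ 2 * (q * q) → 2 ∣ x →
                     ∃[ P′ ] ∃[ Q′ ] Congruum P′ Q′ × P′ < P
  evenLeg⇒congruum x y P q 1≤x cop hypotenuse area (divides k x≡k*2) =
    triangle⇒congruum k y P q
      (1≤m*n⇒1≤m k 2 (subst (1 ≤_) x≡k*2 1≤x))
      (subst (λ x → Coprime x y) x≡2*k cop)
      (trans (y²+4k²≡[2k]²+y² k y) (trans (cong (λ x → x * x + y * y) (sym x≡2*k)) hypotenuse))
      (*-cancelˡ-≡ _ _ 2 (trans (sym (*-assoc 2 k y)) (trans (cong (_* y) (sym x≡2*k)) area)))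
    where
    x≡2*k : x ≡ 2 * k
    x≡2*k = trans x≡k*2 (*-comm k 2)

  [q2]²≡2·2q² : ∀ q → q * 2 * (q * 2) ≡ 2 * (2 * (q * q))
  [q2]²≡2·2q² = solve-∀

  -- The triangle with legs s, r has area (Q/2)². Here Q is even, and with Q = 2q the relation s r =
  -- 2q² makes one leg even; the two choices are symmetric.
  squareArea⇒congruum : ∀ s r P Q → 1 ≤ Q → Coprime P Q → s * s + r * r ≡ P * P → 2 * (s * r) ≡ Q * Q →
                        ∃[ P′ ] ∃[ Q′ ] Congruum P′ Q′ × P′ < P
  squareArea⇒congruum s r P Q 1≤Q cop s²+r²≡P² 2sr≡Q² =
    halve (prime∣m²⇒∣m Q prime[2] (∣-respʳ-≡ 2sr≡Q² (m∣m*n (s * r))))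
    where
    1≤sr : 1 ≤ s * r
    1≤sr = 1≤m*n⇒1≤n 2 (s * r) (subst (1 ≤_) (sym 2sr≡Q²) (*-mono-≤ 1≤Q 1≤Q))
    1≤s : 1 ≤ s
    1≤s = 1≤m*n⇒1≤m s r 1≤sr
    1≤r : 1 ≤ r
    1≤r = 1≤m*n⇒1≤n s r 1≤sr
    cop-sr : Coprime s r
    cop-sr = noCommonPrime⇒coprime s r {{>-nonZero 1≤r}} λ pp p∣s p∣r →
      coprime⇒noCommonPrime cop pp
        (prime∣m²⇒∣m P pp (∣-respʳ-≡ s²+r²≡P² (∣m∣n⇒∣m+n (∣m⇒∣m*n s p∣s) (∣m⇒∣m*n r p∣r))))
        (prime∣m²⇒∣m Q pp (∣-respʳ-≡ 2sr≡Q² (∣n⇒∣m*n 2 (∣m⇒∣m*n r p∣s))))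
    halve : 2 ∣ Q → ∃[ P′ ] ∃[ Q′ ] Congruum P′ Q′ × P′ < P
    halve (divides q Q≡q*2) =
      [ evenLeg⇒congruum s r P q 1≤s cop-sr s²+r²≡P² area
      , evenLeg⇒congruum r s P q 1≤r (Co.sym cop-sr) (trans (+-comm (r * r) (s * s)) s²+r²≡P²) (trans (*-comm r s) area)
      ]′ (euclidsLemma s r prime[2] (∣-respʳ-≡ (sym area) (m∣m*n (q * q))))
      where
      area : s * r ≡ 2 * (q * q)
      area = *-cancelˡ-≡ _ _ 2 (trans 2sr≡Q² (trans (cong₂ _*_ Q≡q*2 Q≡q*2) ([q2]²≡2·2q² q)))

  d²+2Q²≡d²+Q²+Q² : ∀ d Q → d * d + 2 * (Q * Q) ≡ d * d + Q * Q + Q * Q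
  d²+2Q²≡d²+Q²+Q² = solve-∀

  s²+[d+s]²≡d²+2s[d+s] : ∀ d s → s * s + (d + s) * (d + s) ≡ d * d + 2 * (s * (d + s))
  s²+[d+s]²≡d²+2s[d+s] = solve-∀

  -- The legs are the half-difference s and the half-sum r of c and d: s² + r² = (c² + d²)/2 = P²
  -- and 2sr = (c² - d²)/2 = Q².
  congruum-descent : ∀ P Q → Congruum P Q → ∃[ P′ ] ∃[ Q′ ] Congruum P′ Q′ × P′ < P
  congruum-descent P Q (cop , 1≤Q , (c , sum) , (d , difference)) =
    halfSumAndDifference (even-difference-of-squares d c (Q * Q) (trans (d²+2Q²≡d²+Q²+Q² d Q) (trans (cong (_+ Q * Q) difference) sum)))
    where
    halfSumAndDifference : (∃[ s ] c ≡ d + 2 * s × 2 * (s * (d + s)) ≡ Q * Q) → ∃[ P′ ] ∃[ Q′ ] Congruum P′ Q′ × P′ < P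
    halfSumAndDifference (s , _ , 2sr≡Q²) = squareArea⇒congruum s (d + s) P Q 1≤Q cop
      (trans (s²+[d+s]²≡d²+2s[d+s] d s) (trans (cong (d * d +_) 2sr≡Q²) difference)) 2sr≡Q²

  ¬congruum : ∀ P Q → ¬ Congruum P Q
  ¬congruum = <-rec (λ P → ∀ Q → ¬ Congruum P Q) λ P ih Q congruum →
    let P′ , Q′ , congruum′ , P′<P = congruum-descent P Q congruum in ih P′<P Q′ congruum′

  -- The equation u⁴ - B⁴ = v².

  h[2b+h]+b²≡[b+h]² : ∀ b h → h * (b + (b + h)) + b * b ≡ (b + h) * (b + h)
  h[2b+h]+b²≡[b+h]² = solve-∀

  b+[b+h]≡h+2b : ∀ b h → b + (b + h) ≡ h + 2 * b
  b+[b+h]≡h+2b = solve-∀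

  [k+b]+k≡b+k2 : ∀ k b → (k + b) + k ≡ b + k * 2
  [k+b]+k≡b+k2 = solve-∀

  [w2]²≡4w² : ∀ w → w * 2 * (w * 2) ≡ 4 * (w * w)
  [w2]²≡4w² = solve-∀

  4k[k+b]≡k2[2b+k2] : ∀ k b → 4 * (k * (k + b)) ≡ k * 2 * (b + (b + k * 2))
  4k[k+b]≡k2[2b+k2] = solve-∀

  -- Factor v² as h e with h = u² - B² and e = u² + B². If these are coprime, both are squares and
  -- (u, B) is a forbidden pair. Otherwise their only common prime is 2, and h/2 = t², e/2 = s² give
  -- s² + t² = u² and s² - t² = B², so (s, t) is a forbidden pair.
  no-biquadrate-difference : ∀ u B v → 1 ≤ B → 1 ≤ v → Coprime u B → v * v + (B * B) * (B * B) ≢ (u * u) * (u * u)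
  no-biquadrate-difference u B v 1≤B 1≤v cop eq =
    fromDifference (B * B) refl (m≤n⇒∃[o]m+o≡n (m²≤n²⇒m≤n (≤-trans (m≤n+m (B * B * (B * B)) (v * v)) (≤-reflexive eq))))
    where
    fromDifference : ∀ b² → b² ≡ B * B → (∃[ h ] B * B + h ≡ u * u) → ⊥
    fromDifference b² b²≡B² (h , B²+h≡u²) = split (coprime⊎commonPrime h e {{>-nonZero 1≤e}})
      where
      e = b² + (b² + h)
      b²+h≡u² : b² + h ≡ u * u
      b²+h≡u² = trans (cong (_+ h) b²≡B²) B²+h≡u²
      1≤b² : 1 ≤ b²
      1≤b² = subst (1 ≤_) (sym b²≡B²) (*-mono-≤ 1≤B 1≤B)
      1≤e : 1 ≤ e
      1≤e = ≤-trans 1≤b² (m≤m+n b² (b² + h))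
      ∣b²⇒∣B : ∀ {p} → Prime p → p ∣ b² → p ∣ B
      ∣b²⇒∣B pp p∣b² = prime∣m²⇒∣m B pp (∣-respʳ-≡ b²≡B² p∣b²)
      he≡v² : h * e ≡ v * v
      he≡v² = +-cancelʳ-≡ (b² * b²) _ _ (begin
        h * e + b² * b²         ≡⟨ h[2b+h]+b²≡[b+h]² b² h ⟩
        (b² + h) * (b² + h)     ≡⟨ cong₂ _*_ b²+h≡u² b²+h≡u² ⟩
        (u * u) * (u * u)       ≡⟨ sym eq ⟩
        v * v + B * B * (B * B) ≡⟨ cong (v * v +_) (cong₂ _*_ (sym b²≡B²) (sym b²≡B²)) ⟩
        v * v + b² * b²         ∎)
        where open ≡-Reasoning
      split : Coprime h e ⊎ (∃[ p ] Prime p × p ∣ h × p ∣ e) → ⊥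
      split (inj₁ cop-he) with coprime-product-squares h e v cop-he he≡v²
      ... | (d , h≡d²) , (c , e≡c²) = ¬congruum u B
        (cop , 1≤B ,
         (c , trans (+-comm (u * u) (B * B)) (trans (cong₂ _+_ (sym b²≡B²) (sym b²+h≡u²)) e≡c²)) ,
         (d , trans (cong (_+ B * B) (sym h≡d²)) (trans (+-comm h (B * B)) B²+h≡u²)))
      split (inj₂ (p , pp , p∣h , p∣e)) = even (subst (_∣ h) p≡2 p∣h)
        where
        -- The prime divides e - h = 2B²; if it divided B² it would divide u² = B² + h too.
        p≡2 : p ≡ 2
        p≡2 with euclidsLemma 2 b² pp (∣m+n∣m⇒∣n (∣-respʳ-≡ (b+[b+h]≡h+2b b² h) p∣e) p∣h)
        ... | inj₁ p∣2 = prime∣prime⇒≡ pp prime[2] p∣2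
        ... | inj₂ p∣b² = ⊥-elim (coprime⇒noCommonPrime cop pp
          (prime∣m²⇒∣m u pp (∣-respʳ-≡ b²+h≡u² (∣m∣n⇒∣m+n p∣b² p∣h))) (∣b²⇒∣B pp p∣b²))
        even : 2 ∣ h → ⊥
        even 2∣h@(divides k h≡k*2) = halve (prime∣m²⇒∣m v prime[2] (∣-respʳ-≡ he≡v² (∣m⇒∣m*n e 2∣h)))
          where
          [k+b²]+k≡u² : (k + b²) + k ≡ u * u
          [k+b²]+k≡u² = trans ([k+b]+k≡b+k2 k b²) (trans (cong (b² +_) (sym h≡k*2)) b²+h≡u²)
          cop-k : Coprime k (k + b²)
          cop-k = noCommonPrime⇒coprime k (k + b²) {{>-nonZero (≤-trans 1≤b² (m≤n+m b² k))}} λ qp q∣k q∣k+b² →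
            coprime⇒noCommonPrime cop qp
              (prime∣m²⇒∣m u qp (∣-respʳ-≡ [k+b²]+k≡u² (∣m∣n⇒∣m+n q∣k+b² q∣k)))
              (∣b²⇒∣B qp (∣m+n∣m⇒∣n q∣k+b² q∣k))
          1≤k : 1 ≤ k
          1≤k = 1≤m*n⇒1≤m k 2 (subst (1 ≤_) h≡k*2 (1≤m*n⇒1≤m h e (subst (1 ≤_) (sym he≡v²) (*-mono-≤ 1≤v 1≤v))))
          halve : 2 ∣ v → ⊥
          halve (divides w v≡w*2) = conclude (coprime-product-squares k (k + b²) w cop-k product≡)
            where
            product≡ : k * (k + b²) ≡ w * w
            product≡ = *-cancelˡ-≡ _ _ 4 (begin
              4 * (k * (k + b²))            ≡⟨ 4k[k+b]≡k2[2b+k2] k b² ⟩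
              k * 2 * (b² + (b² + k * 2))   ≡⟨ cong (λ h → h * (b² + (b² + h))) (sym h≡k*2) ⟩
              h * e                         ≡⟨ he≡v² ⟩
              v * v                         ≡⟨ cong₂ _*_ v≡w*2 v≡w*2 ⟩
              w * 2 * (w * 2)               ≡⟨ [w2]²≡4w² w ⟩
              4 * (w * w)                   ∎)
              where open ≡-Reasoning
            conclude : (∃[ t ] k ≡ t * t) × (∃[ s ] k + b² ≡ s * s) → ⊥
            conclude ((t , k≡t²) , (s , k+b²≡s²)) = ¬congruum s t
              (cop-st , 1≤m²⇒1≤m (subst (1 ≤_) k≡t² 1≤k) ,
               (u , trans (cong₂ _+_ (sym k+b²≡s²) (sym k≡t²)) [k+b²]+k≡u²) ,
               (B , trans (cong₂ _+_ (sym b²≡B²) (sym k≡t²)) (trans (+-comm b² k) k+b²≡s²)))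
              where
              cop-st : Coprime s t
              cop-st (x∣s , x∣t) = cop-k (∣-respʳ-≡ (sym k≡t²) (∣m⇒∣m*n t x∣t) , ∣-respʳ-≡ (sym k+b²≡s²) (∣m⇒∣m*n s x∣s))

  -- Upper bounds for the radical.

  product-distinctPrimes-∣ : ∀ m {ps} → Unique ps → All Prime ps → All (_∣ m) ps → product ps ∣ m
  product-distinctPrimes-∣ m [] [] [] = 1∣ m
  product-distinctPrimes-∣ m {p ∷ ps} (p≢ps ∷ uniq) (pp ∷ primes) (divides k m≡k*p ∷ divisors) =
    ∣-respʳ-≡ (trans (*-comm p k) (sym m≡k*p))
      (*-monoʳ-∣ p (product-distinctPrimes-∣ k uniq primes (All.zipWith divide (All.zip (p≢ps , primes) , divisors))))
    where
    divide : ∀ {q} → (p ≢ q × Prime q) × q ∣ m → q ∣ k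
    divide ((p≢q , qp) , q∣m) with euclidsLemma k p qp (∣-respʳ-≡ m≡k*p q∣m)
    ... | inj₁ q∣k = q∣k
    ... | inj₂ q∣p = contradiction (sym (prime∣prime⇒≡ qp pp q∣p)) p≢q

  -- A product of distinct primes that all divide m divides m. Hence the application of ABC only has
  -- to trace prime divisors into one explicit number.
  rad-≤ : ∀ n m → 1 ≤ m → (∀ {p} → Prime p → p ∣ n → p ∣ m) → rad n ≤ m
  rad-≤ n m 1≤m primes∣m = ∣⇒≤ {{>-nonZero 1≤m}}
    (product-distinctPrimes-∣ m (filter⁺ P? (upTo⁺ (suc n))) (All.map proj₁ all) (All.map (λ (pp , p∣n) → primes∣m pp p∣n) all))
    where
    P? = λ p → prime? p ×-dec p ∣? n
    all : All (λ p → Prime p × p ∣ n) (primeDivisors n)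
    all = all-filter P? (upTo (suc n))

  -- One of the two factors of N B⁴ divides 2N.

  coprime-fourthPower : ∀ d B → 1 ≤ B → Coprime d B → Coprime d (B * B * (B * B))
  coprime-fourthPower d B 1≤B cop =
    coprime-squareʳ {{>-nonZero (*-mono-≤ 1≤B 1≤B)}} (coprime-squareʳ {{>-nonZero 1≤B}} cop)

  -- Phrased as the equality of any two prime divisors, so that B = 1 and prime powers are treated
  -- alike.
  AtMostOnePrime : ℕ → Set
  AtMostOnePrime B = ∀ {p q} → Prime p → Prime q → p ∣ B → q ∣ B → p ≡ q

  -- A prime p ∣ B dividing both d and e divides 2u², so p = 2; it cannot divide both d/2 and e/2.
  factor∣2N : ∀ N B u d e → 1 ≤ B → Coprime u B → AtMostOnePrime B →
              d * e ≡ N * (B * B * (B * B)) → d + e ≡ 2 * (u * u) → d ∣ 2 * N ⊎ e ∣ 2 * N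
  factor∣2N N B u d e 1≤B cop unique de≡ d+e≡ = cases (coprime⊎commonPrime d B) (coprime⊎commonPrime e B)
    where
    instance
      B≢0 : NonZero B
      B≢0 = >-nonZero 1≤B
    coprime⇒∣N : ∀ {x} y → Coprime x B → x * y ≡ N * (B * B * (B * B)) → x ∣ N
    coprime⇒∣N {x} y cop-x xy≡ = coprime-divisor (coprime-fourthPower x B 1≤B cop-x)
      (∣-respʳ-≡ (trans xy≡ (*-comm N (B * B * (B * B)))) (m∣m*n y))
    cases : Coprime d B ⊎ (∃[ p ] Prime p × p ∣ d × p ∣ B) → Coprime e B ⊎ (∃[ q ] Prime q × q ∣ e × q ∣ B) →
            d ∣ 2 * N ⊎ e ∣ 2 * N
    cases (inj₁ cop-d) _ = inj₁ (∣n⇒∣m*n 2 (coprime⇒∣N e cop-d de≡))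
    cases (inj₂ _) (inj₁ cop-e) = inj₂ (∣n⇒∣m*n 2 (coprime⇒∣N d cop-e (trans (*-comm e d) de≡)))
    cases (inj₂ (p , pp , p∣d , p∣B)) (inj₂ (q , qp , q∣e , q∣B)) = halve (subst (_∣ d) p≡2 p∣d) (subst (_∣ e) (trans (unique qp pp q∣B p∣B) p≡2) q∣e)
      where
      p≡2 : p ≡ 2
      p≡2 with euclidsLemma 2 (u * u) pp (∣-respʳ-≡ d+e≡ (∣m∣n⇒∣m+n p∣d (subst (_∣ e) (unique qp pp q∣B p∣B) q∣e)))
      ... | inj₁ p∣2  = prime∣prime⇒≡ pp prime[2] p∣2
      ... | inj₂ p∣u² = ⊥-elim (coprime⇒noCommonPrime cop pp (prime∣m²⇒∣m u pp p∣u²) p∣B)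
      halve : 2 ∣ d → 2 ∣ e → d ∣ 2 * N ⊎ e ∣ 2 * N
      halve (divides d′ d≡) (divides e′ e≡) = cases′ (coprime⊎commonPrime d′ B) (coprime⊎commonPrime e′ B)
        where
        d′+e′≡u² : d′ + e′ ≡ u * u
        d′+e′≡u² = *-cancelˡ-≡ _ _ 2 (trans (trans (*-comm 2 (d′ + e′)) (*-distribʳ-+ 2 d′ e′)) (trans (cong₂ _+_ (sym d≡) (sym e≡)) d+e≡))
        double : ∀ {x x′} y → x ≡ x′ * 2 → x * y ≡ N * (B * B * (B * B)) → Coprime x′ B → x ∣ 2 * N
        double {x} {x′} y x≡ xy≡ cop-x′ = subst₂ _∣_ (sym x≡) (*-comm N 2) (*-monoˡ-∣ 2
          (coprime⇒∣N (2 * y) cop-x′ (trans (sym (*-assoc x′ 2 y)) (trans (cong (_* y) (sym x≡)) xy≡))))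
        cases′ : Coprime d′ B ⊎ (∃[ p ] Prime p × p ∣ d′ × p ∣ B) → Coprime e′ B ⊎ (∃[ q ] Prime q × q ∣ e′ × q ∣ B) →
                 d ∣ 2 * N ⊎ e ∣ 2 * N
        cases′ (inj₁ cop-d′) _ = inj₁ (double e d≡ de≡ cop-d′)
        cases′ (inj₂ _) (inj₁ cop-e′) = inj₂ (double d e≡ (trans (*-comm e d) de≡) cop-e′)
        cases′ (inj₂ (p′ , pp′ , p′∣d′ , p′∣B)) (inj₂ (q′ , qp′ , q′∣e′ , q′∣B)) = ⊥-elim (coprime⇒noCommonPrime cop pp′
          (prime∣m²⇒∣m u pp′ (∣-respʳ-≡ d′+e′≡u² (∣m∣n⇒∣m+n p′∣d′ (subst (_∣ e′) (unique qp′ pp′ q′∣B p′∣B) q′∣e′)))) p′∣B)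

  -- ABC applied to 2d + f B⁴ = 4u².

  reduceByGCD : ∀ m n → 1 ≤ m → ∃[ g ] ∃[ a ] ∃[ b ] 1 ≤ g × m ≡ a * g × n ≡ b * g × Coprime a b
  reduceByGCD m n 1≤m = reduce (gcd[m,n]∣m m n) (gcd[m,n]∣n m n)
    where
    g = gcd m n
    g≢0 : NonZero g
    g≢0 = ≢-nonZero (gcd[m,n]≢0 m n (inj₁ (m<n⇒n≢0 1≤m)))
    reduce : g ∣ m → g ∣ n → ∃[ g ] ∃[ a ] ∃[ b ] 1 ≤ g × m ≡ a * g × n ≡ b * g × Coprime a b
    reduce (divides a m≡) (divides b n≡) = g , a , b , >-nonZero⁻¹ g {{g≢0}} , m≡ , n≡ ,
      Co.GCD≡1⇒coprime (GCD-* {c = g} {{g≢0}} (subst₂ (λ x y → GCD x y (1 * g)) m≡ n≡ (subst (GCD m n) (sym (*-identityˡ g)) (gcd-GCD m n))))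

  ^-distribʳ-* : ∀ m n o → (m * n) ^ o ≡ m ^ o * n ^ o
  ^-distribʳ-* m n zero    = refl
  ^-distribʳ-* m n (suc o) = trans (cong (m * n *_) (^-distribʳ-* m n o)) (interchange m n (m ^ o) (n ^ o))
    where open import Algebra.Properties.CommutativeSemigroup *-commutativeSemigroup using (interchange)

  ABC¼ : ℕ → Set
  ABC¼ K = ∀ a b c → 1 ≤ a → 1 ≤ b → Coprime a b → a + b ≡ c → c ^ 4 ≤ K ^ 4 * rad (a * b * c) ^ 5

  square-^ : ∀ m n → (m * m) ^ n ≡ m ^ (n + n)
  square-^ m n = trans (^-distribʳ-* m m n) (sym (^-distribˡ-+-* m n n))

  -- u¹⁶ ≤ c⁸N⁸ ≤ K⁸M¹⁰N⁸ ≤ K⁸A⁵N⁸ · u¹⁵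
  cancelPowers : ∀ u c N K M A → 1 ≤ u → u * u ≤ c * N → c ^ 4 ≤ K ^ 4 * M ^ 5 → M * M ≤ A * u ^ 3 →
                 u ≤ K ^ 8 * A ^ 5 * N ^ 8
  cancelPowers u c N K M A 1≤u u²≤cN c⁴≤ M²≤ = *-cancelʳ-≤ u _ (u ^ 15) {{m^n≢0 u 15 {{>-nonZero 1≤u}}}} (begin
    u ^ 16                                        ≡⟨ square-^ u 8 ⟨
    (u * u) ^ 8                                   ≤⟨ ^-monoˡ-≤ 8 u²≤cN ⟩
    (c * N) ^ 8                                   ≡⟨ ^-distribʳ-* c N 8 ⟩
    c ^ 8 * N ^ 8                                 ≡⟨ cong (_* N ^ 8) (^-distribˡ-+-* c 4 4) ⟩
    c ^ 4 * c ^ 4 * N ^ 8                         ≤⟨ *-monoˡ-≤ (N ^ 8) (*-mono-≤ c⁴≤ c⁴≤) ⟩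
    K ^ 4 * M ^ 5 * (K ^ 4 * M ^ 5) * N ^ 8       ≡⟨ cong (_* N ^ 8) (interchange (K ^ 4) (M ^ 5) (K ^ 4) (M ^ 5)) ⟩
    K ^ 4 * K ^ 4 * (M ^ 5 * M ^ 5) * N ^ 8       ≡⟨ cong₂ (λ x y → x * y * N ^ 8) (^-distribˡ-+-* K 4 4) (^-distribʳ-* M M 5) ⟨
    K ^ 8 * (M * M) ^ 5 * N ^ 8                   ≤⟨ *-monoˡ-≤ (N ^ 8) (*-monoʳ-≤ (K ^ 8) (^-monoˡ-≤ 5 M²≤)) ⟩
    K ^ 8 * (A * u ^ 3) ^ 5 * N ^ 8               ≡⟨ cong (λ x → K ^ 8 * x * N ^ 8) (trans (^-distribʳ-* A (u ^ 3) 5) (cong (A ^ 5 *_) (^-*-assoc u 3 5))) ⟩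
    K ^ 8 * (A ^ 5 * u ^ 15) * N ^ 8              ≡⟨ rearrange (K ^ 8) (A ^ 5) (u ^ 15) (N ^ 8) ⟩
    K ^ 8 * A ^ 5 * N ^ 8 * u ^ 15                ∎)
    where
    open ≤-Reasoning
    open import Algebra.Properties.CommutativeSemigroup *-commutativeSemigroup using (interchange; xy∙z≈xz∙y)
    rearrange : ∀ k a x n → k * (a * x) * n ≡ k * a * n * x
    rearrange k a x n = trans (cong (_* n) (sym (*-assoc k a x))) (xy∙z≈xz∙y (k * a) x n)

  [4nbu]²≡16n²b²u² : ∀ n b u → 4 * n * b * u * (4 * n * b * u) ≡ 16 * (n * n) * (b * b * (u * u))
  [4nbu]²≡16n²b²u² = solve-∀

  16n²·2uu²≡32n²u³ : ∀ n u → 16 * (n * n) * (2 * u * (u * u)) ≡ 32 * (n * n) * (u * (u * (u * 1)))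
  16n²·2uu²≡32n²u³ = solve-∀

  [2u]²≡4u² : ∀ u → 2 * u * (2 * u) ≡ 4 * (u * u)
  [2u]²≡4u² = solve-∀

  abcBound : ∀ K → ABC¼ K → ∀ N B u d f → 1 ≤ N → 1 ≤ B → 1 ≤ u → f * d ≡ 2 * N →
             2 * d + f * (B * B * (B * B)) ≡ 4 * (u * u) → u ≤ K ^ 8 * (32 * (N * N)) ^ 5 * N ^ 8
  -- ABC asks for coprime summands. The gcd g divides 2d, so g ≤ 4N, and dividing it out costs one
  -- factor N in the lower bound for c.
  abcBound K abc N B u d f 1≤N 1≤B 1≤u fd≡2N sum = reduced (reduceByGCD (2 * d) (f * B⁴) (*-mono-≤ {1} {2} (s≤s z≤n) 1≤d))
    where
    open ≤-Reasoning
    B⁴ = B * B * (B * B)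
    1≤2N : 1 ≤ 2 * N
    1≤2N = *-mono-≤ {1} {2} (s≤s z≤n) 1≤N
    1≤f : 1 ≤ f
    1≤f = 1≤m*n⇒1≤m f d (subst (1 ≤_) (sym fd≡2N) 1≤2N)
    1≤d : 1 ≤ d
    1≤d = 1≤m*n⇒1≤n f d (subst (1 ≤_) (sym fd≡2N) 1≤2N)
    1≤B² : 1 ≤ B * B
    1≤B² = *-mono-≤ 1≤B 1≤B
    d≤2N : d ≤ 2 * N
    d≤2N = ∣⇒≤ {{>-nonZero 1≤2N}} (divides f (sym fd≡2N))
    B²≤2u : B * B ≤ 2 * u
    B²≤2u = m²≤n²⇒m≤n (begin
      B⁴              ≤⟨ m≤n*m B⁴ f {{>-nonZero 1≤f}} ⟩
      f * B⁴          ≤⟨ m≤n+m (f * B⁴) (2 * d) ⟩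
      2 * d + f * B⁴  ≡⟨ sum ⟩
      4 * (u * u)     ≡⟨ [2u]²≡4u² u ⟨
      2 * u * (2 * u) ∎)
    -- Since 4N = 2fd, this number contains every prime of 2d, of f B⁴ and of 4u².
    M = 4 * N * B * u
    1≤M : 1 ≤ M
    1≤M = *-mono-≤ (*-mono-≤ (*-mono-≤ {1} {4} (s≤s z≤n) 1≤N) 1≤B) 1≤u
    M²≤ : M * M ≤ 32 * (N * N) * u ^ 3
    M²≤ = begin
      M * M                                ≡⟨ [4nbu]²≡16n²b²u² N B u ⟩
      16 * (N * N) * (B * B * (u * u))     ≤⟨ *-monoʳ-≤ (16 * (N * N)) (*-monoˡ-≤ (u * u) B²≤2u) ⟩
      16 * (N * N) * (2 * u * (u * u))     ≡⟨ 16n²·2uu²≡32n²u³ N u ⟩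
      32 * (N * N) * u ^ 3                 ∎
    4N≡2fd : 4 * N ≡ 2 * (f * d)
    4N≡2fd = trans (*-assoc 2 2 N) (cong (2 *_) (sym fd≡2N))
    ∣4N⇒∣M : ∀ {p} → p ∣ 4 * N → p ∣ M
    ∣4N⇒∣M p∣4N = ∣m⇒∣m*n u (∣m⇒∣m*n B p∣4N)
    ∣2⇒∣M : ∀ {p} → p ∣ 2 → p ∣ M
    ∣2⇒∣M p∣2 = ∣4N⇒∣M (∣-respʳ-≡ (sym 4N≡2fd) (∣m⇒∣m*n (f * d) p∣2))
    ∣2d⇒∣M : ∀ {p} → Prime p → p ∣ 2 * d → p ∣ M
    ∣2d⇒∣M pp p∣2d with euclidsLemma 2 d pp p∣2d
    ... | inj₁ p∣2 = ∣2⇒∣M p∣2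
    ... | inj₂ p∣d = ∣4N⇒∣M (∣-respʳ-≡ (sym 4N≡2fd) (∣n⇒∣m*n 2 (∣n⇒∣m*n f p∣d)))
    ∣fB⁴⇒∣M : ∀ {p} → Prime p → p ∣ f * B⁴ → p ∣ M
    ∣fB⁴⇒∣M pp p∣fB⁴ with euclidsLemma f B⁴ pp p∣fB⁴
    ... | inj₁ p∣f  = ∣4N⇒∣M (∣-respʳ-≡ (sym 4N≡2fd) (∣n⇒∣m*n 2 (∣m⇒∣m*n d p∣f)))
    ... | inj₂ p∣B⁴ = ∣m⇒∣m*n u (∣n⇒∣m*n (4 * N) (prime∣m²⇒∣m B pp (prime∣m²⇒∣m (B * B) pp p∣B⁴)))
    ∣4u²⇒∣M : ∀ {p} → Prime p → p ∣ 4 * (u * u) → p ∣ M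
    ∣4u²⇒∣M pp p∣4u² with euclidsLemma 2 u pp (prime∣m²⇒∣m (2 * u) pp (∣-respʳ-≡ (sym ([2u]²≡4u² u)) p∣4u²))
    ... | inj₁ p∣2 = ∣2⇒∣M p∣2
    ... | inj₂ p∣u = ∣n⇒∣m*n (4 * N * B) p∣u
    reduced : (∃[ g ] ∃[ a ] ∃[ b ] 1 ≤ g × 2 * d ≡ a * g × f * B⁴ ≡ b * g × Coprime a b) →
              u ≤ K ^ 8 * (32 * (N * N)) ^ 5 * N ^ 8
    reduced (g , a , b , 1≤g , 2d≡ag , fB⁴≡bg , cop) =
      cancelPowers u (a + b) N K M (32 * (N * N)) 1≤u u²≤cN
        (≤-trans (abc a b (a + b) 1≤a 1≤b cop refl) (*-monoʳ-≤ (K ^ 4) (^-monoˡ-≤ 5 rad≤M))) M²≤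
      where
      1≤a : 1 ≤ a
      1≤a = 1≤m*n⇒1≤m a g (subst (1 ≤_) 2d≡ag (*-mono-≤ {1} {2} (s≤s z≤n) 1≤d))
      1≤b : 1 ≤ b
      1≤b = 1≤m*n⇒1≤m b g (subst (1 ≤_) fB⁴≡bg (*-mono-≤ 1≤f (*-mono-≤ 1≤B² 1≤B²)))
      [a+b]g≡4u² : (a + b) * g ≡ 4 * (u * u)
      [a+b]g≡4u² = trans (*-distribʳ-+ g a b) (trans (cong₂ _+_ (sym 2d≡ag) (sym fB⁴≡bg)) sum)
      g≤4N : g ≤ 4 * N
      g≤4N = begin
        g           ≤⟨ m≤n*m g a {{>-nonZero 1≤a}} ⟩
        a * g       ≡⟨ 2d≡ag ⟨
        2 * d       ≤⟨ *-monoʳ-≤ 2 d≤2N ⟩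
        2 * (2 * N) ≡⟨ *-assoc 2 2 N ⟨
        4 * N       ∎
      u²≤cN : u * u ≤ (a + b) * N
      u²≤cN = *-cancelˡ-≤ 4 (begin
        4 * (u * u)       ≡⟨ [a+b]g≡4u² ⟨
        (a + b) * g       ≤⟨ *-monoʳ-≤ (a + b) g≤4N ⟩
        (a + b) * (4 * N) ≡⟨ x∙yz≈y∙xz (a + b) 4 N ⟩
        4 * ((a + b) * N) ∎)
        where open import Algebra.Properties.CommutativeSemigroup *-commutativeSemigroup using (x∙yz≈y∙xz)
      rad≤M : rad (a * b * (a + b)) ≤ M
      rad≤M = rad-≤ (a * b * (a + b)) M 1≤M λ pp p∣abc →
        [ (λ p∣ab → [ (λ p∣a → ∣2d⇒∣M pp (∣-respʳ-≡ (sym 2d≡ag) (∣m⇒∣m*n g p∣a)))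
                    , (λ p∣b → ∣fB⁴⇒∣M pp (∣-respʳ-≡ (sym fB⁴≡bg) (∣m⇒∣m*n g p∣b))) ]′ (euclidsLemma a b pp p∣ab))
        , (λ p∣c → ∣4u²⇒∣M pp (∣-respʳ-≡ [a+b]g≡4u² (∣m⇒∣m*n g p∣c))) ]′ (euclidsLemma (a * b) (a + b) pp p∣abc)

  d[d+2v]+v²≡[v+d]² : ∀ v d → d * (d + 2 * v) + v * v ≡ (v + d) * (v + d)
  d[d+2v]+v²≡[v+d]² = solve-∀

  d+[d+2v]≡2[v+d] : ∀ v d → d + (d + 2 * v) ≡ 2 * (v + d)
  d+[d+2v]≡2[v+d] = solve-∀

  2·2x≡4x : ∀ x → 2 * (2 * x) ≡ 4 * x
  2·2x≡4x = solve-∀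

  -- The factors d = u² - v and e = u² + v have product N B⁴ and sum 2u². If d f = 2N, cancelling d
  -- from d f B⁴ = 2 d e gives f B⁴ = 2e, so 2d + f B⁴ = 2(d + e) = 4u²; the roles of d and e may be
  -- exchanged.
  numeratorBound : ∀ K → ABC¼ K → ∀ N B u v → 1 ≤ N → 1 ≤ B → Coprime u B → AtMostOnePrime B →
                   v * v + N * (B * B * (B * B)) ≡ u * u * (u * u) → u ≤ K ^ 8 * (32 * (N * N)) ^ 5 * N ^ 8
  numeratorBound K abc N B u v 1≤N 1≤B cop unique eq =
    fromDifference (m≤n⇒∃[o]m+o≡n (m²≤n²⇒m≤n (≤-trans (m≤m+n (v * v) (N * (B * B * (B * B)))) (≤-reflexive eq))))
    where
    1≤B² : 1 ≤ B * B
    1≤B² = *-mono-≤ 1≤B 1≤B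
    fromDivisor : ∀ d e → d * e ≡ N * (B * B * (B * B)) → d + e ≡ 2 * (u * u) → d ∣ 2 * N →
                  u ≤ K ^ 8 * (32 * (N * N)) ^ 5 * N ^ 8
    fromDivisor d e de≡ d+e≡ (divides f 2N≡fd) = abcBound K abc N B u d f 1≤N 1≤B 1≤u (sym 2N≡fd) sum
      where
      open ≡-Reasoning
      1≤d : 1 ≤ d
      1≤d = 1≤m*n⇒1≤m d e (subst (1 ≤_) (sym de≡) (*-mono-≤ 1≤N (*-mono-≤ 1≤B² 1≤B²)))
      1≤u : 1 ≤ u
      1≤u = 1≤m²⇒1≤m (1≤m*n⇒1≤n 2 (u * u) (≤-trans 1≤d (≤-trans (m≤m+n d e) (≤-reflexive d+e≡))))
      fB⁴≡2e : f * (B * B * (B * B)) ≡ 2 * e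
      fB⁴≡2e = *-cancelˡ-≡ _ _ d {{>-nonZero 1≤d}} (begin
        d * (f * (B * B * (B * B)))   ≡⟨ *-assoc d f _ ⟨
        d * f * (B * B * (B * B))     ≡⟨ cong (_* (B * B * (B * B))) (trans (*-comm d f) (sym 2N≡fd)) ⟩
        2 * N * (B * B * (B * B))     ≡⟨ *-assoc 2 N _ ⟩
        2 * (N * (B * B * (B * B)))   ≡⟨ cong (2 *_) de≡ ⟨
        2 * (d * e)                   ≡⟨ x∙yz≈y∙xz 2 d e ⟩
        d * (2 * e)                   ∎)
        where open import Algebra.Properties.CommutativeSemigroup *-commutativeSemigroup using (x∙yz≈y∙xz)
      sum : 2 * d + f * (B * B * (B * B)) ≡ 4 * (u * u)
      sum = begin
        2 * d + f * (B * B * (B * B)) ≡⟨ cong (2 * d +_) fB⁴≡2e ⟩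
        2 * d + 2 * e                 ≡⟨ *-distribˡ-+ 2 d e ⟨
        2 * (d + e)                   ≡⟨ cong (2 *_) d+e≡ ⟩
        2 * (2 * (u * u))             ≡⟨ 2·2x≡4x (u * u) ⟩
        4 * (u * u)                   ∎
    fromDifference : (∃[ d ] v + d ≡ u * u) → u ≤ K ^ 8 * (32 * (N * N)) ^ 5 * N ^ 8
    fromDifference (d , v+d≡u²) =
      [ fromDivisor d e de≡ d+e≡ , fromDivisor e d (trans (*-comm e d) de≡) (trans (+-comm e d) d+e≡) ]′
        (factor∣2N N B u d e 1≤B cop unique de≡ d+e≡)
      where
      e = d + 2 * v
      de≡ : d * e ≡ N * (B * B * (B * B))
      de≡ = +-cancelʳ-≡ (v * v) _ _ (trans (d[d+2v]+v²≡[v+d]² v d) (trans (cong₂ _*_ v+d≡u² v+d≡u²) (trans (sym eq) (+-comm (v * v) _))))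
      d+e≡ : d + e ≡ 2 * (u * u)
      d+e≡ = trans (d+[d+2v]≡2[v+d] v d) (cong (2 *_) v+d≡u²)

  -- Absorbing the ABC constant into a power of N.

  m<2^m : ∀ m → m < 2 ^ m
  m<2^m zero    = s≤s z≤n
  m<2^m (suc m) = begin
    suc (suc m)           ≡⟨ cong suc (+-comm 1 m) ⟩
    suc m + 1             ≤⟨ +-mono-≤ (m<2^m m) (m^n>0 2 m) ⟩
    2 ^ m + 2 ^ m         ≡⟨ cong (2 ^ m +_) (+-identityʳ (2 ^ m)) ⟨
    2 * 2 ^ m             ∎
    where open ≤-Reasoning

  -- For N ≥ 2 one has K ≤ 2^K ≤ N^K and 32 = 2^5 ≤ N^5. The middle factor is therefore at most
  -- (N^7)^5, which is the source of 35.
  absorbConstant : ∀ K N → 2 ≤ N → K ^ 8 * (32 * (N * N)) ^ 5 * N ^ 8 ≤ N ^ (K * 8 + 35 + 8)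
  absorbConstant K N 2≤N = begin
    K ^ 8 * (32 * (N * N)) ^ 5 * N ^ 8          ≤⟨ *-monoˡ-≤ (N ^ 8) (*-mono-≤ (^-monoˡ-≤ 8 K≤N^K) (^-monoˡ-≤ 5 (*-monoˡ-≤ (N * N) (^-monoˡ-≤ 5 2≤N)))) ⟩
    (N ^ K) ^ 8 * (N ^ 5 * (N * N)) ^ 5 * N ^ 8 ≡⟨ cong₂ (λ x y → x * y * N ^ 8) (^-*-assoc N K 8) (trans (cong (_^ 5) N⁵N²≡N⁷) (^-*-assoc N 7 5)) ⟩
    N ^ (K * 8) * N ^ 35 * N ^ 8                ≡⟨ cong (_* N ^ 8) (^-distribˡ-+-* N (K * 8) 35) ⟨
    N ^ (K * 8 + 35) * N ^ 8                    ≡⟨ ^-distribˡ-+-* N (K * 8 + 35) 8 ⟨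
    N ^ (K * 8 + 35 + 8)                        ∎
    where
    open ≤-Reasoning
    K≤N^K : K ≤ N ^ K
    K≤N^K = ≤-trans (<⇒≤ (m<2^m K)) (^-monoˡ-≤ K 2≤N)
    N⁵N²≡N⁷ : N ^ 5 * (N * N) ≡ N ^ 7
    N⁵N²≡N⁷ = trans (cong (λ x → N ^ 5 * (N * x)) (sym (*-identityʳ N))) (sym (^-distribˡ-+-* N 5 2))

  -- Twice the exponent of `absorbConstant`: that one bounds u, while x(Q) = (u/B)².
  heightExponent : ℕ → ℕ
  heightExponent K = (K * 8 + 35 + 8) + (K * 8 + 35 + 8)

  -- For N = 1 no constant can be absorbed, and Fermat's theorem gives u = B instead.
  squareHeight : ∀ K → ABC¼ K → ∀ N B u v → 1 ≤ N → 1 ≤ B → Coprime u B → AtMostOnePrime B →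
                 v * v + N * (B * B * (B * B)) ≡ u * u * (u * u) → u * u ≤ N ^ heightExponent K * (B * B)
  -- Fermat's theorem excludes only v ≥ 1; for v = 0 the equation itself gives u² = B².
  squareHeight K abc 1 B u zero 1≤N 1≤B cop unique eq = ≤-reflexive
    (trans (m²≡n²⇒m≡n (u * u) (B * B) (trans (sym eq) (*-identityˡ _))) (sym (trans (cong (_* (B * B)) (^-zeroˡ (heightExponent K))) (*-identityˡ _))))
  squareHeight K abc 1 B u v@(suc _) 1≤N 1≤B cop unique eq =
    ⊥-elim (no-biquadrate-difference u B v 1≤B (s≤s z≤n) cop (trans (cong (v * v +_) (sym (*-identityˡ _))) eq))
  squareHeight K abc N@(suc (suc _)) B u v 1≤N 1≤B cop unique eq = begin
    u * u                                             ≤⟨ *-mono-≤ u≤ u≤ ⟩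
    N ^ (K * 8 + 35 + 8) * N ^ (K * 8 + 35 + 8)       ≡⟨ ^-distribˡ-+-* N (K * 8 + 35 + 8) (K * 8 + 35 + 8) ⟨
    N ^ heightExponent K                              ≤⟨ m≤m*n _ (B * B) {{>-nonZero (*-mono-≤ 1≤B 1≤B)}} ⟩
    N ^ heightExponent K * (B * B)                    ∎
    where
    open ≤-Reasoning
    u≤ : u ≤ N ^ (K * 8 + 35 + 8)
    u≤ = ≤-trans (numeratorBound K abc N B u v 1≤N 1≤B cop unique eq) (absorbConstant K N (s≤s (s≤s z≤n)))

module Descent where
  open Arithmetic
  open import Data.Integer as ℤ using (-[1+_])
  import Data.Integer.Properties as ℤ
  open import Data.List using (List; []; _∷_; length)
  open import Data.List.Membership.Propositional using (_∈_)
  open import Data.List.Membership.Propositional.Properties using (∈-filter⁺; ∈-upTo⁺)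
  open import Data.List.Relation.Unary.Any using (here)
  open import Data.Nat as ℕ using (zero; suc; s≤s; z≤n)
  import Data.Nat.Properties as ℕ
  open import Data.Rational hiding (neg)
  open import Data.Rational.Properties
  open import Data.Rational.Unnormalised as ℚᵘ using (mkℚᵘ)
  open import Data.Unit using (tt)
  open import Level using (0ℓ)
  open import Relation.Nullary.Decidable using (dec⇒maybe)
  import Tactic.RingSolver as RingSolver
  import Tactic.RingSolver.Core.AlmostCommutativeRing as ACR

  -- Lines meeting the curve, through Vieta's relations.

  ℚ-ring : ACR.AlmostCommutativeRing 0ℓ 0ℓ
  ℚ-ring = ACR.fromCommutativeRing +-*-commutativeRing (λ p → dec⇒maybe (0ℚ ≟ p))

  -p*-p≡p*p : ∀ p → (- p) * (- p) ≡ p * p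
  -p*-p≡p*p = RingSolver.solve-∀ ℚ-ring

  p²q²≡[pq]² : ∀ p q → p * p * (q * q) ≡ p * q * (p * q)
  p²q²≡[pq]² = RingSolver.solve-∀ ℚ-ring

  pqr≡prq : ∀ p q r → p * q * r ≡ p * r * q
  pqr≡prq = RingSolver.solve-∀ ℚ-ring

  pqr≡q[pr] : ∀ p q r → p * q * r ≡ q * (p * r)
  pqr≡q[pr] = RingSolver.solve-∀ ℚ-ring

  -- The line y = lx + m meets the curve at the roots of x³ - l²x² - (n + 2lm)x - m², with m = y - l
  -- x₁. The first Vieta relation defines x₃. Up to the factor x₂ - x₁, the second is the difference
  -- of the curve equations at the two given points.
  chord-identity : ∀ n x₁ x₂ l y → (x₂ - x₁) * (x₁ * x₂ + (x₁ + x₂) * (l * l - x₁ - x₂) + n + (l * (y - l * x₁) + l * (y - l * x₁)))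
    ≡ ((y + l * (x₂ - x₁)) * (y + l * (x₂ - x₁)) - (x₂ * x₂ * x₂ - n * x₂)) - (y * y - (x₁ * x₁ * x₁ - n * x₁))
  chord-identity = RingSolver.solve-∀ ℚ-ring

  -- For a double point the factor x₂ - x₁ vanishes; the second Vieta relation is then the equation
  -- 2y l = 3x² - n for the slope.
  tangent-identity : ∀ n x l y → x * x + (x + x) * (l * l - x - x) + n + (l * (y - l * x) + l * (y - l * x))
    ≡ l * (ℕ→ℚ 2 * y) - (ℕ→ℚ 3 * x * x - n)
  tangent-identity = RingSolver.solve-∀ ℚ-ring

  -- The third Vieta relation x₁x₂x₃ = m² follows from the second one and the curve equation at the
  -- first point.
  product-identity : ∀ n x₁ x₂ l y → (y - l * x₁) * (y - l * x₁) - x₁ * x₂ * (l * l - x₁ - x₂)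
    ≡ (y * y - (x₁ * x₁ * x₁ - n * x₁))
      - x₁ * (x₁ * x₂ + (x₁ + x₂) * (l * l - x₁ - x₂) + n + (l * (y - l * x₁) + l * (y - l * x₁)))
  product-identity = RingSolver.solve-∀ ℚ-ring

  third-point-identity : ∀ n x₁ x₂ l y → (l * (x₁ - (l * l - x₁ - x₂)) - y) * (l * (x₁ - (l * l - x₁ - x₂)) - y)
      - ((l * l - x₁ - x₂) * (l * l - x₁ - x₂) * (l * l - x₁ - x₂) - n * (l * l - x₁ - x₂))
    ≡ ((l * l - x₁ - x₂) - x₁) * (x₁ * x₂ + (x₁ + x₂) * (l * l - x₁ - x₂) + n + (l * (y - l * x₁) + l * (y - l * x₁)))
      + (y * y - (x₁ * x₁ * x₁ - n * x₁))
  third-point-identity = RingSolver.solve-∀ ℚ-ring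

  p≡q⇒p-q≡0 : ∀ {p q} → p ≡ q → p - q ≡ 0ℚ
  p≡q⇒p-q≡0 {p} refl = +-inverseʳ p

  p-q+q≡p : ∀ p q → p - q + q ≡ p
  p-q+q≡p = RingSolver.solve-∀ ℚ-ring

  p-q≡0⇒p≡q : ∀ p q → p - q ≡ 0ℚ → p ≡ q
  p-q≡0⇒p≡q p q eq = trans (sym (p-q+q≡p p q)) (trans (cong (_+ q) eq) (+-identityˡ q))

  inv-inverse : ∀ q → q ≢ 0ℚ → inv q * q ≡ 1ℚ
  inv-inverse q q≢0 with q ≟ 0ℚ
  ... | yes q≡0 = contradiction q≡0 q≢0
  ... | no  q≢0′ = *-inverseˡ q {{≢-nonZero q≢0′}}

  p*q≡0⇒q≡0 : ∀ p q → p ≢ 0ℚ → p * q ≡ 0ℚ → q ≡ 0ℚ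
  p*q≡0⇒q≡0 p q p≢0 pq≡0 = begin
    q                 ≡⟨ *-identityˡ q ⟨
    1ℚ * q            ≡⟨ cong (_* q) (inv-inverse p p≢0) ⟨
    inv p * p * q     ≡⟨ *-assoc (inv p) p q ⟩
    inv p * (p * q)   ≡⟨ cong (inv p *_) pq≡0 ⟩
    inv p * 0ℚ        ≡⟨ *-zeroʳ (inv p) ⟩
    0ℚ                ∎
    where open ≡-Reasoning

  p²≡0⇒p≡0 : ∀ p → p * p ≡ 0ℚ → p ≡ 0ℚ
  p²≡0⇒p≡0 p p²≡0 with p ≟ 0ℚ
  ... | yes p≡0 = p≡0
  ... | no  p≢0 = p*q≡0⇒q≡0 p p p≢0 p²≡0

  -- Second elementary symmetric function condition for the line y = l x + m (m = y₁ - l x₁)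
  -- to meet the curve in points with abscissae x₁, x₂ and l² - x₁ - x₂.
  MeetsAt : ℚ → ℚ → ℚ → ℚ → ℚ → Set
  MeetsAt n x₁ x₂ l m = x₁ * x₂ + (x₁ + x₂) * (l * l - x₁ - x₂) + n + (l * m + l * m) ≡ 0ℚ

  chord-meetsAt : ∀ n x₁ y₁ x₂ y₂ → x₁ ≢ x₂ → y₁ * y₁ ≡ x₁ * x₁ * x₁ - n * x₁ → y₂ * y₂ ≡ x₂ * x₂ * x₂ - n * x₂ →
    let l = (y₂ - y₁) * inv (x₂ - x₁) in MeetsAt n x₁ x₂ l (y₁ - l * x₁)
  chord-meetsAt n x₁ y₁ x₂ y₂ x₁≢x₂ on₁ on₂ = p*q≡0⇒q≡0 (x₂ - x₁) _ Δ≢0 (trans (chord-identity n x₁ x₂ l y₁)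
    (cong₂ _-_ (p≡q⇒p-q≡0 (trans (cong₂ _*_ y₁+lΔ≡y₂ y₁+lΔ≡y₂) on₂)) (p≡q⇒p-q≡0 on₁)))
    where
    l = (y₂ - y₁) * inv (x₂ - x₁)
    Δ≢0 : x₂ - x₁ ≢ 0ℚ
    Δ≢0 Δ≡0 = x₁≢x₂ (sym (p-q≡0⇒p≡q x₂ x₁ Δ≡0))
    lΔ≡ : l * (x₂ - x₁) ≡ y₂ - y₁
    lΔ≡ = trans (*-assoc (y₂ - y₁) (inv (x₂ - x₁)) (x₂ - x₁))
      (trans (cong ((y₂ - y₁) *_) (inv-inverse (x₂ - x₁) Δ≢0)) (*-identityʳ (y₂ - y₁)))
    y₁+lΔ≡y₂ : y₁ + l * (x₂ - x₁) ≡ y₂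
    y₁+lΔ≡y₂ = trans (cong (y₁ +_) lΔ≡) (trans (+-comm y₁ (y₂ - y₁)) (p-q+q≡p y₂ y₁))

  tangent-meetsAt : ∀ n x y → ℕ→ℚ 2 * y ≢ 0ℚ →
    let l = (ℕ→ℚ 3 * x * x - n) * inv (ℕ→ℚ 2 * y) in MeetsAt n x x l (y - l * x)
  tangent-meetsAt n x y 2y≢0 = trans (tangent-identity n x l y) (p≡q⇒p-q≡0
    (trans (*-assoc (ℕ→ℚ 3 * x * x - n) (inv (ℕ→ℚ 2 * y)) (ℕ→ℚ 2 * y))
      (trans (cong ((ℕ→ℚ 3 * x * x - n) *_) (inv-inverse (ℕ→ℚ 2 * y) 2y≢0)) (*-identityʳ _))))
    where
    l = (ℕ→ℚ 3 * x * x - n) * inv (ℕ→ℚ 2 * y)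

  meetsAt⇒onCurve : ∀ n x₁ y₁ x₂ l → y₁ * y₁ ≡ x₁ * x₁ * x₁ - n * x₁ → MeetsAt n x₁ x₂ l (y₁ - l * x₁) →
    let x₃ = l * l - x₁ - x₂; y₃ = l * (x₁ - x₃) - y₁ in y₃ * y₃ ≡ x₃ * x₃ * x₃ - n * x₃
  meetsAt⇒onCurve n x₁ y₁ x₂ l on₁ meets = p-q≡0⇒p≡q _ _ (trans (third-point-identity n x₁ x₂ l y₁)
    (trans (cong₂ (λ p q → ((l * l - x₁ - x₂) - x₁) * p + q) meets (p≡q⇒p-q≡0 on₁))
      (trans (+-identityʳ _) (*-zeroʳ ((l * l - x₁ - x₂) - x₁)))))

  meetsAt⇒product≡m² : ∀ n x₁ y₁ x₂ l → y₁ * y₁ ≡ x₁ * x₁ * x₁ - n * x₁ → MeetsAt n x₁ x₂ l (y₁ - l * x₁) →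
    (y₁ - l * x₁) * (y₁ - l * x₁) ≡ x₁ * x₂ * (l * l - x₁ - x₂)
  meetsAt⇒product≡m² n x₁ y₁ x₂ l on₁ meets = p-q≡0⇒p≡q _ _ (trans (product-identity n x₁ x₂ l y₁)
    (cong₂ _-_ (p≡q⇒p-q≡0 on₁) (trans (cong (x₁ *_) meets) (*-zeroʳ x₁))))

  -- The descent map modulo squares and its compatibility with addition.

  IsSquare : ℚ → Set
  IsSquare q = ∃[ r ] q ≡ r * r

  -- The 2-isogeny descent map E(ℚ) → ℚ*/ℚ*², with a representative for each class.
  descentAt : ℕ → ℚ → ℚ
  descentAt N x with x ≟ 0ℚ
  ... | yes _ = - ℕ→ℚ N
  ... | no  _ = x

  descent : ℕ → Pt → ℚ
  descent N O        = 1ℚ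
  descent N (af x y) = descentAt N x

  descentAt-0 : ∀ N x → x ≡ 0ℚ → descentAt N x ≡ - ℕ→ℚ N
  descentAt-0 N x x≡0 with x ≟ 0ℚ
  ... | yes _   = refl
  ... | no  x≢0 = contradiction x≡0 x≢0

  descentAt-≢0 : ∀ N x → x ≢ 0ℚ → descentAt N x ≡ x
  descentAt-≢0 N x x≢0 with x ≟ 0ℚ
  ... | yes x≡0 = contradiction x≡0 x≢0
  ... | no  _   = refl

  ℕ→ℚ≢0 : ∀ n → 1 ℕ.≤ n → ℕ→ℚ n ≢ 0ℚ
  ℕ→ℚ≢0 n@(suc _) _ n≡0 = <⇒≢ (positive⁻¹ (ℕ→ℚ n) {{normalize-pos n 1}}) (sym n≡0)

  -p≡0⇒p≡0 : ∀ p → - p ≡ 0ℚ → p ≡ 0ℚ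
  -p≡0⇒p≡0 p eq = neg-injective eq

  descentAt-nonzero : ∀ N x → 1 ℕ.≤ N → descentAt N x ≢ 0ℚ
  descentAt-nonzero N x 1≤N with x ≟ 0ℚ
  ... | yes _   = λ eq → ℕ→ℚ≢0 N 1≤N (-p≡0⇒p≡0 (ℕ→ℚ N) eq)
  ... | no  x≢0 = x≢0

  descent-nonzero : ∀ N P → 1 ℕ.≤ N → descent N P ≢ 0ℚ
  descent-nonzero N O        1≤N = 1≢0
  descent-nonzero N (af x y) 1≤N = descentAt-nonzero N x 1≤N

  -- This is the relation between the other two abscissae on a line through (0,0). As N > 0, neither
  -- is 0, so the exceptional value of `descentAt` is not met.
  descentAt-opposite : ∀ N x y → 1 ℕ.≤ N → x * y ≡ - ℕ→ℚ N → descentAt N x * descentAt N y ≡ - ℕ→ℚ N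
  descentAt-opposite N x y 1≤N xy≡ = trans (cong₂ _*_ (descentAt-≢0 N x x≢0) (descentAt-≢0 N y y≢0)) xy≡
    where
    -N≢0 : - ℕ→ℚ N ≢ 0ℚ
    -N≢0 eq = ℕ→ℚ≢0 N 1≤N (-p≡0⇒p≡0 (ℕ→ℚ N) eq)
    x≢0 : x ≢ 0ℚ
    x≢0 refl = -N≢0 (trans (sym xy≡) (*-zeroˡ y))
    y≢0 : y ≢ 0ℚ
    y≢0 refl = -N≢0 (trans (sym xy≡) (*-zeroʳ x))

  drop-zero-terms : ∀ p n l → p + n + (l * 0ℚ + l * 0ℚ) ≡ p - (- n)
  drop-zero-terms = RingSolver.solve-∀ ℚ-ring

  symmetric₂-0₁ : ∀ x y → 0ℚ * x + (0ℚ + x) * y ≡ x * y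
  symmetric₂-0₁ = RingSolver.solve-∀ ℚ-ring

  symmetric₂-0₂ : ∀ x y → x * 0ℚ + (x + 0ℚ) * y ≡ x * y
  symmetric₂-0₂ = RingSolver.solve-∀ ℚ-ring

  symmetric₂-0₃ : ∀ x y → x * y + (x + y) * 0ℚ ≡ x * y
  symmetric₂-0₃ = RingSolver.solve-∀ ℚ-ring

  -- If no abscissa vanishes, the product is m². If one does, then m = 0, the second Vieta relation
  -- makes the product of the other two -N, and the representative -N of (0,0) completes it to
  -- (-N)².
  descentAt-product : ∀ N x₁ x₂ x₃ l m → 1 ℕ.≤ N → x₁ * x₂ + (x₁ + x₂) * x₃ + ℕ→ℚ N + (l * m + l * m) ≡ 0ℚ → m * m ≡ x₁ * x₂ * x₃ →
    IsSquare (descentAt N x₁ * descentAt N x₂ * descentAt N x₃)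
  descentAt-product N x₁ x₂ x₃ l m 1≤N e₂ m²≡ = cases (x₁ ≟ 0ℚ) (x₂ ≟ 0ℚ) (x₃ ≟ 0ℚ)
    where
    δ = descentAt N
    -n = - ℕ→ℚ N
    m≡0⇒ : m ≡ 0ℚ → x₁ * x₂ + (x₁ + x₂) * x₃ ≡ -n
    m≡0⇒ refl = p-q≡0⇒p≡q _ -n (trans (sym (drop-zero-terms (x₁ * x₂ + (x₁ + x₂) * x₃) (ℕ→ℚ N) l)) e₂)
    conclude : ∀ {x} y z → x ≡ 0ℚ → y * z ≡ -n → IsSquare (δ y * δ z * δ x)
    conclude y z x≡0 yz≡ = -n , cong₂ _*_ (descentAt-opposite N y z 1≤N yz≡) (descentAt-0 N _ x≡0)
    cases : Dec (x₁ ≡ 0ℚ) → Dec (x₂ ≡ 0ℚ) → Dec (x₃ ≡ 0ℚ) → IsSquare (δ x₁ * δ x₂ * δ x₃)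
    cases (no x₁≢0) (no x₂≢0) (no x₃≢0) = m , trans
      (cong₂ _*_ (cong₂ _*_ (descentAt-≢0 N x₁ x₁≢0) (descentAt-≢0 N x₂ x₂≢0)) (descentAt-≢0 N x₃ x₃≢0)) (sym m²≡)
    cases (yes refl) _ _ = subst IsSquare (trans (*-comm (δ x₂ * δ x₃) (δ 0ℚ)) (sym (*-assoc (δ 0ℚ) (δ x₂) (δ x₃))))
      (conclude x₂ x₃ refl (trans (sym (symmetric₂-0₁ x₂ x₃))
        (m≡0⇒ (p²≡0⇒p≡0 m (trans m²≡ (trans (cong (_* x₃) (*-zeroˡ x₂)) (*-zeroˡ x₃)))))))
    cases (no _) (yes refl) _ = subst IsSquare (pqr≡prq (δ x₁) (δ x₃) (δ 0ℚ))
      (conclude x₁ x₃ refl (trans (sym (symmetric₂-0₂ x₁ x₃))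
        (m≡0⇒ (p²≡0⇒p≡0 m (trans m²≡ (trans (cong (_* x₃) (*-zeroʳ x₁)) (*-zeroˡ x₃)))))))
    cases (no _) (no _) (yes refl) =
      conclude x₁ x₂ refl (trans (sym (symmetric₂-0₃ x₁ x₂)) (m≡0⇒ (p²≡0⇒p≡0 m (trans m²≡ (*-zeroʳ (x₁ * x₂))))))

  add-descent : ∀ N P Q → 1 ℕ.≤ N → OnCurve N P → OnCurve N Q →
    OnCurve N (add N P Q) × IsSquare (descent N P * descent N Q * descent N (add N P Q))
  add-descent N O Q 1≤N onP onQ = onQ , descent N Q , cong (_* descent N Q) (*-identityˡ (descent N Q))
  add-descent N (af x y) O 1≤N onP onQ = onP , descentAt N x , cong (_* descentAt N x) (*-identityʳ (descentAt N x))
  add-descent N (af x₁ y₁) (af x₂ y₂) 1≤N onP onQ with x₁ ≟ x₂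
  ... | no x₁≢x₂ = meetsAt⇒onCurve n x₁ y₁ x₂ l onP meets ,
    descentAt-product N x₁ x₂ _ l (y₁ - l * x₁) 1≤N meets (meetsAt⇒product≡m² n x₁ y₁ x₂ l onP meets)
    where
    n = ℕ→ℚ N
    l = (y₂ - y₁) * inv (x₂ - x₁)
    meets : MeetsAt n x₁ x₂ l (y₁ - l * x₁)
    meets = chord-meetsAt n x₁ y₁ x₂ y₂ x₁≢x₂ onP onQ
  ... | yes refl with y₁ ≟ (- y₂)
  ...   | yes _ = tt , descentAt N x₁ , *-identityʳ _
  ...   | no y₁≢-y₂ = meetsAt⇒onCurve n x₁ y₁ x₁ l onP meets ,
    descentAt-product N x₁ x₁ _ l (y₁ - l * x₁) 1≤N meets (meetsAt⇒product≡m² n x₁ y₁ x₁ l onP meets)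
    where
    n = ℕ→ℚ N
    l = (ℕ→ℚ 3 * x₁ * x₁ - n) * inv (ℕ→ℚ 2 * y₁)
    2y₁≢0 : ℕ→ℚ 2 * y₁ ≢ 0ℚ
    -- If y₁ = 0, the common abscissa gives y₂² = y₁² = 0, so y₁ = -y₂, which is the excluded
    -- branch.
    2y₁≢0 2y₁≡0 with refl ← p*q≡0⇒q≡0 (ℕ→ℚ 2) y₁ (λ ()) 2y₁≡0 =
      y₁≢-y₂ (cong (-_) (sym (p²≡0⇒p≡0 y₂ (trans onQ (sym onP)))))
    meets : MeetsAt n x₁ x₁ l (y₁ - l * x₁)
    meets = tangent-meetsAt n x₁ y₁ 2y₁≢0

  -- Classes of multiples and of the elements of the span.

  cancelSquare : ∀ p q → p ≢ 0ℚ → IsSquare p → IsSquare (p * q) → IsSquare q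
  cancelSquare p q p≢0 (s , p≡s²) (t , pq≡t²) = inv s * t , (begin
    q                               ≡⟨ *-identityˡ q ⟨
    1ℚ * q                          ≡⟨ cong (λ z → z * z * q) (inv-inverse s s≢0) ⟨
    inv s * s * (inv s * s) * q     ≡⟨ regroup (inv s) s q ⟩
    inv s * inv s * (s * s * q)     ≡⟨ cong (λ z → inv s * inv s * (z * q)) p≡s² ⟨
    inv s * inv s * (p * q)         ≡⟨ cong (inv s * inv s *_) pq≡t² ⟩
    inv s * inv s * (t * t)         ≡⟨ p²q²≡[pq]² (inv s) t ⟩
    inv s * t * (inv s * t)         ∎)
    where
    open ≡-Reasoning
    s≢0 : s ≢ 0ℚ
    s≢0 refl = p≢0 p≡s²
    regroup : ∀ i s q → i * s * (i * s) * q ≡ i * i * (s * s * q)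
    regroup = RingSolver.solve-∀ ℚ-ring

  -- For nonzero d and q: the class of q lies in the subgroup of ℚ*/ℚ*² generated by d, which is {1,
  -- d} because every class is its own inverse.
  SquareUpTo : ℚ → ℚ → Set
  SquareUpTo d q = IsSquare q ⊎ IsSquare (d * q)

  -- Adding P multiplies the class by that of P, which exchanges the two alternatives.
  multiple-descent : ∀ N P k → 1 ℕ.≤ N → OnCurve N P →
    OnCurve N (mulℕ N k P) × SquareUpTo (descent N P) (descent N (mulℕ N k P))
  multiple-descent N P zero    1≤N onP = tt , inj₁ (1ℚ , refl)
  multiple-descent N P (suc k) 1≤N onP with multiple-descent N P k 1≤N onP
  ... | onkP , class with add-descent N P (mulℕ N k P) 1≤N onP onkP
  ...   | on , square = on , next class
    where
    δ = descent N P
    δₖ = descent N (mulℕ N k P)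
    δₖ₊₁ = descent N (mulℕ N (suc k) P)
    next : SquareUpTo δ δₖ → SquareUpTo δ δₖ₊₁
    next (inj₁ even) = inj₂ (cancelSquare δₖ (δ * δₖ₊₁) (descent-nonzero N (mulℕ N k P) 1≤N) even (subst IsSquare (pqr≡q[pr] δ δₖ δₖ₊₁) square))
    next (inj₂ odd) = inj₁ (cancelSquare (δ * δₖ) δₖ₊₁ nonzero odd square)
      where
      nonzero : δ * δₖ ≢ 0ℚ
      nonzero eq = descent-nonzero N (mulℕ N k P) 1≤N (p*q≡0⇒q≡0 δ δₖ (descent-nonzero N P 1≤N) eq)

  neg-onCurve : ∀ N P → OnCurve N P → OnCurve N (neg P)
  neg-onCurve N O        _  = tt
  neg-onCurve N (af x y) on = trans (-p*-p≡p*p y) on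

  descent-neg : ∀ N P → descent N (neg P) ≡ descent N P
  descent-neg N O        = refl
  descent-neg N (af x y) = refl

  integerMultiple-descent : ∀ N P k → 1 ℕ.≤ N → OnCurve N P →
    OnCurve N (mul N k P) × SquareUpTo (descent N P) (descent N (mul N k P))
  integerMultiple-descent N P (ℤ.+ k)  1≤N onP = multiple-descent N P k 1≤N onP
  integerMultiple-descent N P -[1+ k ] 1≤N onP with multiple-descent N P (suc k) 1≤N onP
  ... | on , class = neg-onCurve N _ on , subst (SquareUpTo (descent N P)) (sym (descent-neg N (mulℕ N (suc k) P))) class

  -- When P₂ has trivial class, both alternatives for a multiple of P₂ say that its class is
  -- trivial. So Q has the class of its P₁-part.
  span-descent : ∀ N P₁ P₂ Q → 1 ℕ.≤ N → OnCurve N P₁ → OnCurve N P₂ → IsSquare (descent N P₂) → InSpan N P₁ P₂ Q →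
    OnCurve N Q × SquareUpTo (descent N P₁) (descent N Q)
  span-descent N P₁ P₂ Q 1≤N on₁ on₂ square₂ (a , b , refl)
    with integerMultiple-descent N P₁ a 1≤N on₁ | integerMultiple-descent N P₂ b 1≤N on₂
  ... | onA , classA | onB , classB with add-descent N (mul N a P₁) (mul N b P₂) 1≤N onA onB
  ...   | onQ , square = onQ , combine classA
    where
    A = mul N a P₁
    B = mul N b P₂
    δ = descent N
    squareB : IsSquare (δ B)
    squareB = [ (λ s → s) , cancelSquare (δ P₂) (δ B) (descent-nonzero N P₂ 1≤N) square₂ ]′ classB
    squareAQ : IsSquare (δ A * δ Q)
    squareAQ = cancelSquare (δ B) (δ A * δ Q) (descent-nonzero N B 1≤N) squareB (subst IsSquare (pqr≡q[pr] (δ A) (δ B) (δ Q)) square)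
    combine : SquareUpTo (δ P₁) (δ A) → SquareUpTo (δ P₁) (δ Q)
    combine (inj₁ squareA) = inj₁ (cancelSquare (δ A) (δ Q) (descent-nonzero N A 1≤N) squareA squareAQ)
    combine (inj₂ squareP₁A) = inj₂ (cancelSquare (δ A * δ A) (δ P₁ * δ Q) AA≢0 (δ A , refl)
      (subst IsSquare (regroup (δ P₁) (δ A) (δ Q)) (square-* squareP₁A squareAQ)))
      where
      AA≢0 : δ A * δ A ≢ 0ℚ
      AA≢0 eq = descent-nonzero N A 1≤N (p²≡0⇒p≡0 (δ A) eq)
      regroup : ∀ p a q → p * a * (a * q) ≡ a * a * (p * q)
      regroup = RingSolver.solve-∀ ℚ-ring
      square-* : ∀ {p q} → IsSquare p → IsSquare q → IsSquare (p * q)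
      square-* (s , refl) (t , refl) = s * t , p²q²≡[pq]² s t

  -- Naturals inside ℚ and fractions in lowest terms.

  ℕ→ℚ-mkℚ : ∀ n → ℕ→ℚ n ≡ mkℚ (ℤ.+ n) 0 (Co.sym (Co.1-coprimeTo n))
  ℕ→ℚ-mkℚ n = normalize-coprime (Co.sym (Co.1-coprimeTo n))

  ℕ→ℚ-injective : ∀ m n → ℕ→ℚ m ≡ ℕ→ℚ n → m ≡ n
  ℕ→ℚ-injective m n eq = ℤ.+-injective (cong ↥_ (trans (sym (ℕ→ℚ-mkℚ m)) (trans eq (ℕ→ℚ-mkℚ n))))

  ℕ→ℚ-* : ∀ m n → ℕ→ℚ (m ℕ.* n) ≡ ℕ→ℚ m * ℕ→ℚ n
  ℕ→ℚ-* m n rewrite ℕ→ℚ-mkℚ m | ℕ→ℚ-mkℚ n = cong (_/ 1) (ℤ.pos-* m n)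

  ℕ→ℚ-+ : ∀ m n → ℕ→ℚ (m ℕ.+ n) ≡ ℕ→ℚ m + ℕ→ℚ n
  ℕ→ℚ-+ m n rewrite ℕ→ℚ-mkℚ m | ℕ→ℚ-mkℚ n =
    cong (_/ 1) (trans (ℤ.pos-+ m n) (cong₂ ℤ._+_ (sym (ℤ.*-identityʳ (ℤ.+ m))) (sym (ℤ.*-identityʳ (ℤ.+ n)))))

  ℕ→ℚ-mono-≤ : ∀ {m n} → m ℕ.≤ n → ℕ→ℚ m ≤ ℕ→ℚ n
  ℕ→ℚ-mono-≤ {m} {n} m≤n rewrite ℕ→ℚ-mkℚ m | ℕ→ℚ-mkℚ n = *≤* (ℤ.*-monoʳ-≤-nonNeg (ℤ.+ 1) (ℤ.+≤+ m≤n))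

  ℕ→ℚ-^ : ∀ n p → ℕ→ℚ n ^ℚ p ≡ ℕ→ℚ (n ℕ.^ p)
  ℕ→ℚ-^ n zero    = refl
  ℕ→ℚ-^ n (suc p) = trans (cong (ℕ→ℚ n *_) (ℕ→ℚ-^ n p)) (sym (ℕ→ℚ-* n (n ℕ.^ p)))

  ∣q∣*denominator : ∀ q → ∣ q ∣ * ℕ→ℚ (↧ₙ q) ≡ ℕ→ℚ ℤ.∣ ↥ q ∣
  ∣q∣*denominator (mkℚ n d-1 c) rewrite ℕ→ℚ-mkℚ (suc d-1) =
    fromℚᵘ-cong {mkℚᵘ (ℤ.+ ℤ.∣ n ∣ ℤ.* ℤ.+ suc d-1) (d-1 ℕ.* 1)} {mkℚᵘ (ℤ.+ ℤ.∣ n ∣) 0}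
      (ℚᵘ.*≡* (trans (ℤ.*-identityʳ _) (cong (λ k → ℤ.+ ℤ.∣ n ∣ ℤ.* ℤ.+ suc k) (sym (ℕ.*-identityʳ d-1)))))

  numerator-coprime : ∀ q → Coprime ℤ.∣ ↥ q ∣ (↧ₙ q)
  numerator-coprime (mkℚ n d-1 c) = Co.recompute c

  ∣q∣² : ∀ q → ∣ q ∣ * ∣ q ∣ ≡ q * q
  ∣q∣² q with ∣p∣≡p∨∣p∣≡-p q
  ... | inj₁ eq = cong₂ _*_ eq eq
  ... | inj₂ eq = trans (cong₂ _*_ eq eq) (-p*-p≡p*p q)

  -- Squaring forgets the sign, so the numerator can be taken in ℕ.
  square-lowestTerms : ∀ q → ∃[ u ] ∃[ B ] 1 ℕ.≤ B × Coprime u B × q * q * ℕ→ℚ (B ℕ.* B) ≡ ℕ→ℚ (u ℕ.* u)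
  square-lowestTerms q = ℤ.∣ ↥ q ∣ , ↧ₙ q , s≤s z≤n , numerator-coprime q , square (↧ₙ q) ℤ.∣ ↥ q ∣ (∣q∣*denominator q)
    where
    open ≡-Reasoning
    square : ∀ d n → ∣ q ∣ * ℕ→ℚ d ≡ ℕ→ℚ n → q * q * ℕ→ℚ (d ℕ.* d) ≡ ℕ→ℚ (n ℕ.* n)
    square d n eq = begin
      q * q * ℕ→ℚ (d ℕ.* d)              ≡⟨ cong₂ _*_ (sym (∣q∣² q)) (ℕ→ℚ-* d d) ⟩
      ∣ q ∣ * ∣ q ∣ * (ℕ→ℚ d * ℕ→ℚ d)    ≡⟨ p²q²≡[pq]² ∣ q ∣ (ℕ→ℚ d) ⟩
      ∣ q ∣ * ℕ→ℚ d * (∣ q ∣ * ℕ→ℚ d)    ≡⟨ cong₂ _*_ eq eq ⟩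
      ℕ→ℚ n * ℕ→ℚ n                      ≡⟨ ℕ→ℚ-* n n ⟨
      ℕ→ℚ (n ℕ.* n)                      ∎

  0≤p² : ∀ p → 0ℚ ≤ p * p
  0≤p² p = subst (0ℚ ≤_) (∣q∣² p) (nonNegative⁻¹ _ {{nonNeg*nonNeg⇒nonNeg (∣ p ∣) {{∣-∣-nonNeg p}} (∣ p ∣) {{∣-∣-nonNeg p}}}})

  -- From a point with square abscissa to v² + N B⁴ = u⁴.

  length≤1⇒≡ : ∀ {A : Set} {xs : List A} {x y} → length xs ℕ.≤ 1 → x ∈ xs → y ∈ xs → x ≡ y
  length≤1⇒≡ {xs = _ ∷ []}    _ (here refl) (here refl) = refl
  length≤1⇒≡ {xs = _ ∷ _ ∷ _} (s≤s ())

  ∈-primeDivisors : ∀ {p n} → 1 ℕ.≤ n → Prime p → p ∣ n → p ∈ primeDivisors n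
  ∈-primeDivisors {p} {n} 1≤n pp p∣n = ∈-filter⁺ (λ p → prime? p ×-dec p ∣? n) (∈-upTo⁺ (s≤s (∣⇒≤ {{ℕ.>-nonZero 1≤n}} p∣n))) (pp , p∣n)

  -- With z = c/e in lowest terms the denominators force e² = B⁴.
  clearDenominators : ∀ N u B c e → 1 ℕ.≤ B → 1 ℕ.≤ e → Coprime u B → Coprime c e →
    c ℕ.* c ℕ.* (B ℕ.* B ℕ.* (B ℕ.* B)) ℕ.+ N ℕ.* (e ℕ.* e) ℕ.* (B ℕ.* B ℕ.* (B ℕ.* B)) ≡ u ℕ.* u ℕ.* (u ℕ.* u) ℕ.* (e ℕ.* e) →
    c ℕ.* c ℕ.+ N ℕ.* (B ℕ.* B ℕ.* (B ℕ.* B)) ≡ u ℕ.* u ℕ.* (u ℕ.* u)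
  clearDenominators N u B c e 1≤B 1≤e cop-uB cop-ce eq =
    ℕ.*-cancelʳ-≡ _ _ B⁴ (begin
      (c ℕ.* c ℕ.+ N ℕ.* B⁴) ℕ.* B⁴              ≡⟨ ℕ.*-distribʳ-+ B⁴ (c ℕ.* c) (N ℕ.* B⁴) ⟩
      c ℕ.* c ℕ.* B⁴ ℕ.+ N ℕ.* B⁴ ℕ.* B⁴         ≡⟨ cong (λ x → c ℕ.* c ℕ.* B⁴ ℕ.+ N ℕ.* x ℕ.* B⁴) (sym e²≡B⁴) ⟩
      c ℕ.* c ℕ.* B⁴ ℕ.+ N ℕ.* (e ℕ.* e) ℕ.* B⁴  ≡⟨ eq ⟩
      u⁴ ℕ.* (e ℕ.* e)                           ≡⟨ cong (u⁴ ℕ.*_) e²≡B⁴ ⟩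
      u⁴ ℕ.* B⁴                                  ∎)
    where
    open ≡-Reasoning
    B⁴ = B ℕ.* B ℕ.* (B ℕ.* B)
    u⁴ = u ℕ.* u ℕ.* (u ℕ.* u)
    1≤B² : 1 ℕ.≤ B ℕ.* B
    1≤B² = ℕ.*-mono-≤ 1≤B 1≤B
    instance
      B⁴≢0 : ℕ.NonZero B⁴
      B⁴≢0 = ℕ.>-nonZero (ℕ.*-mono-≤ 1≤B² 1≤B²)
      e≢0 : ℕ.NonZero e
      e≢0 = ℕ.>-nonZero 1≤e
      e²≢0 : ℕ.NonZero (e ℕ.* e)
      e²≢0 = ℕ.>-nonZero (ℕ.*-mono-≤ 1≤e 1≤e)
    cop-u⁴B⁴ : Coprime u⁴ B⁴
    cop-u⁴B⁴ = coprime-squareˡ (coprime-squareˡ (coprime-fourthPower u B 1≤B cop-uB))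
    cop-e²c² : Coprime (e ℕ.* e) (c ℕ.* c)
    cop-e²c² = Co.sym (coprime-squareˡ (coprime-squareʳ cop-ce))
    B⁴∣e² : B⁴ ∣ e ℕ.* e
    B⁴∣e² = coprime-divisor (Co.sym cop-u⁴B⁴) (∣-respʳ-≡ eq (∣m∣n⇒∣m+n (n∣m*n (c ℕ.* c)) (n∣m*n (N ℕ.* (e ℕ.* e)))))
    e²∣B⁴ : e ℕ.* e ∣ B⁴
    e²∣B⁴ = coprime-divisor cop-e²c² (∣m+n∣m⇒∣n
      (∣-respʳ-≡ (trans (sym eq) (ℕ.+-comm (c ℕ.* c ℕ.* B⁴) _)) (n∣m*n u⁴))
      (∣m⇒∣m*n B⁴ (n∣m*n N)))
    e²≡B⁴ : e ℕ.* e ≡ B⁴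
    e²≡B⁴ = ∣-antisym e²∣B⁴ B⁴∣e²

  regroup-curve : ∀ i r n → (i * i) * (r * r * (r * r) * (r * r) - n * (r * r)) ≡ (i * r) * (i * r) * (r * r * (r * r) - n)
  regroup-curve = RingSolver.solve-∀ ℚ-ring

  regroup-denominators : ∀ z² n e² B² → z² * e² * (B² * B²) + n * e² * (B² * B²) ≡ (z² + n) * (B² * B²) * e²
  regroup-denominators = RingSolver.solve-∀ ℚ-ring

  -- Multiplying z² + N = x² by e²B⁴ clears all denominators, with x = u²/B² and z² = c²/e².
  integralEquation : ∀ N x z² u B c e → x * ℕ→ℚ (B ℕ.* B) ≡ ℕ→ℚ (u ℕ.* u) → z² * ℕ→ℚ (e ℕ.* e) ≡ ℕ→ℚ (c ℕ.* c) →
    z² + ℕ→ℚ N ≡ x * x →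
    c ℕ.* c ℕ.* (B ℕ.* B ℕ.* (B ℕ.* B)) ℕ.+ N ℕ.* (e ℕ.* e) ℕ.* (B ℕ.* B ℕ.* (B ℕ.* B)) ≡ u ℕ.* u ℕ.* (u ℕ.* u) ℕ.* (e ℕ.* e)
  integralEquation N x z² u B c e xB²≡u² z²e²≡c² z²+n≡x² = ℕ→ℚ-injective _ _ (begin
    ℕ→ℚ (c ℕ.* c ℕ.* B⁴ ℕ.+ N ℕ.* (e ℕ.* e) ℕ.* B⁴)
      ≡⟨ ℕ→ℚ-+ (c ℕ.* c ℕ.* B⁴) (N ℕ.* (e ℕ.* e) ℕ.* B⁴) ⟩
    ℕ→ℚ (c ℕ.* c ℕ.* B⁴) + ℕ→ℚ (N ℕ.* (e ℕ.* e) ℕ.* B⁴)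
      ≡⟨ cong₂ _+_ (ℕ→ℚ-* (c ℕ.* c) B⁴) (trans (ℕ→ℚ-* (N ℕ.* (e ℕ.* e)) B⁴) (cong (_* ℕ→ℚ B⁴) (ℕ→ℚ-* N (e ℕ.* e)))) ⟩
    ℕ→ℚ (c ℕ.* c) * ℕ→ℚ B⁴ + ℕ→ℚ N * e² * ℕ→ℚ B⁴
      ≡⟨ cong₂ (λ p q → p * q + ℕ→ℚ N * e² * q) (sym z²e²≡c²) (ℕ→ℚ-* (B ℕ.* B) (B ℕ.* B)) ⟩
    z² * e² * (B² * B²) + ℕ→ℚ N * e² * (B² * B²)
      ≡⟨ regroup-denominators z² (ℕ→ℚ N) e² B² ⟩
    (z² + ℕ→ℚ N) * (B² * B²) * e²
      ≡⟨ cong (λ p → p * (B² * B²) * e²) z²+n≡x² ⟩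
    x * x * (B² * B²) * e²
      ≡⟨ cong (_* e²) (p²q²≡[pq]² x B²) ⟩
    x * B² * (x * B²) * e²
      ≡⟨ cong (λ p → p * p * e²) xB²≡u² ⟩
    ℕ→ℚ (u ℕ.* u) * ℕ→ℚ (u ℕ.* u) * e²
      ≡⟨ cong (_* e²) (ℕ→ℚ-* (u ℕ.* u) (u ℕ.* u)) ⟨
    ℕ→ℚ (u ℕ.* u ℕ.* (u ℕ.* u)) * e²
      ≡⟨ ℕ→ℚ-* (u ℕ.* u ℕ.* (u ℕ.* u)) (e ℕ.* e) ⟨
    ℕ→ℚ (u ℕ.* u ℕ.* (u ℕ.* u) ℕ.* (e ℕ.* e))
      ∎)
    where
    open ≡-Reasoning
    B⁴ = B ℕ.* B ℕ.* (B ℕ.* B)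
    B² = ℕ→ℚ (B ℕ.* B)
    e² = ℕ→ℚ (e ℕ.* e)

  -- Dividing the curve equation at x = r² by x gives (y/r)² + N = r⁴.
  squarePoint-equation : ∀ N r y u B → r ≢ 0ℚ → OnCurve N (af (r * r) y) → 1 ℕ.≤ B → Coprime u B →
    r * r * ℕ→ℚ (B ℕ.* B) ≡ ℕ→ℚ (u ℕ.* u) → ∃[ v ] v ℕ.* v ℕ.+ N ℕ.* (B ℕ.* B ℕ.* (B ℕ.* B)) ≡ u ℕ.* u ℕ.* (u ℕ.* u)
  squarePoint-equation N r y u B r≢0 on 1≤B cop r²B²≡u² =
    let c , e , 1≤e , cop-ce , z²e²≡c² = square-lowestTerms z in
    c , clearDenominators N u B c e 1≤B 1≤e cop cop-ce
          (integralEquation N (r * r) (z * z) u B c e r²B²≡u² z²e²≡c² (trans (cong (_+ n) z²≡) (p-q+q≡p (r * r * (r * r)) n)))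
    where
    open ≡-Reasoning
    n = ℕ→ℚ N
    z = inv r * y
    z²≡ : z * z ≡ r * r * (r * r) - n
    z²≡ = begin
      inv r * y * (inv r * y)                                           ≡⟨ p²q²≡[pq]² (inv r) y ⟨
      inv r * inv r * (y * y)                                           ≡⟨ cong (inv r * inv r *_) on ⟩
      inv r * inv r * (r * r * (r * r) * (r * r) - n * (r * r))         ≡⟨ regroup-curve (inv r) r n ⟩
      (inv r * r) * (inv r * r) * (r * r * (r * r) - n)                 ≡⟨ cong (λ p → p * p * (r * r * (r * r) - n)) (inv-inverse r r≢0) ⟩
      1ℚ * (r * r * (r * r) - n)                                        ≡⟨ *-identityˡ _ ⟩
      r * r * (r * r) - n                                               ∎

  crossMultiply : ∀ x u B X D → x * ℕ→ℚ B ≡ ℕ→ℚ u → x * ℕ→ℚ D ≡ ℕ→ℚ X → X ℕ.* B ≡ u ℕ.* D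
  crossMultiply x u B X D xB≡u xD≡X = ℕ→ℚ-injective (X ℕ.* B) (u ℕ.* D) (begin
    ℕ→ℚ (X ℕ.* B)         ≡⟨ ℕ→ℚ-* X B ⟩
    ℕ→ℚ X * ℕ→ℚ B         ≡⟨ cong (_* ℕ→ℚ B) xD≡X ⟨
    x * ℕ→ℚ D * ℕ→ℚ B     ≡⟨ pqr≡prq x (ℕ→ℚ D) (ℕ→ℚ B) ⟩
    x * ℕ→ℚ B * ℕ→ℚ D     ≡⟨ cong (_* ℕ→ℚ D) xB≡u ⟩
    ℕ→ℚ u * ℕ→ℚ D         ≡⟨ ℕ→ℚ-* u D ⟨
    ℕ→ℚ (u ℕ.* D)         ∎)
    where open ≡-Reasoning

  -- X/D and u²/B² are the same fraction. A prime of B is absent from u, so it must come from D;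
  -- this carries the hypothesis on `L` over to B.
  ∣B⇒∣denominator : ∀ u B X D → Coprime u B → X ℕ.* (B ℕ.* B) ≡ u ℕ.* u ℕ.* D → ∀ {p} → Prime p → p ∣ B → p ∣ D
  ∣B⇒∣denominator u B X D cop eq pp p∣B =
    [ (λ p∣u² → ⊥-elim (coprime⇒noCommonPrime cop pp (prime∣m²⇒∣m u pp p∣u²) p∣B)) , (λ p∣D → p∣D) ]′
      (euclidsLemma (u ℕ.* u) D pp (∣-respʳ-≡ eq (∣n⇒∣m*n X (∣m⇒∣m*n B p∣B))))

  squarePoint-atMostOnePrime : ∀ r y u B → Coprime u B → r * r * ℕ→ℚ (B ℕ.* B) ≡ ℕ→ℚ (u ℕ.* u) →
    L (af (r * r) y) ℕ.≤ 1 → AtMostOnePrime B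
  squarePoint-atMostOnePrime r y u B cop r²B²≡u² L≤1 pp qp p∣B q∣B =
    length≤1⇒≡ L≤1 (∈-primeDivisors (s≤s z≤n) pp (∣B⇒∣D pp p∣B)) (∈-primeDivisors (s≤s z≤n) qp (∣B⇒∣D qp q∣B))
    where
    ∣B⇒∣D : ∀ {p} → Prime p → p ∣ B → p ∣ ↧ₙ (r * r)
    ∣B⇒∣D = ∣B⇒∣denominator u B ℤ.∣ ↥ (r * r) ∣ (↧ₙ (r * r)) cop
      (crossMultiply (r * r) (u ℕ.* u) (B ℕ.* B) ℤ.∣ ↥ (r * r) ∣ (↧ₙ (r * r)) r²B²≡u²
        (trans (cong (_* ℕ→ℚ (↧ₙ (r * r))) (sym (0≤p⇒∣p∣≡p (0≤p² r)))) (∣q∣*denominator (r * r))))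

  -- Height bounds for the two classes.

  heightBound : ∀ N p Q → ∣ xc Q ∣ ≤ ℕ→ℚ (N ℕ.^ p) → HeightBound p 1 N Q
  heightBound N p Q bound = subst₂ _≤_ (sym (*-identityʳ ∣ xc Q ∣)) (sym (ℕ→ℚ-^ N p)) bound

  squarePoint-height : ∀ K → ABC¼ K → ∀ N r y → 1 ℕ.≤ N → r ≢ 0ℚ → OnCurve N (af (r * r) y) → L (af (r * r) y) ℕ.≤ 1 →
    HeightBound (heightExponent K) 1 N (af (r * r) y)
  squarePoint-height K abc N r y 1≤N r≢0 on L≤1 =
    let u , B , 1≤B , cop , r²B²≡u² = square-lowestTerms r
        v , eq = squarePoint-equation N r y u B r≢0 on 1≤B cop r²B²≡u²
    in fromLowestTerms u B 1≤B r²B²≡u²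
         (squareHeight K abc N B u v 1≤N 1≤B cop (squarePoint-atMostOnePrime r y u B cop r²B²≡u² L≤1) eq)
    where
    open ≤-Reasoning
    bound = ℕ→ℚ (N ℕ.^ heightExponent K)
    fromLowestTerms : ∀ u B → 1 ℕ.≤ B → r * r * ℕ→ℚ (B ℕ.* B) ≡ ℕ→ℚ (u ℕ.* u) →
      u ℕ.* u ℕ.≤ N ℕ.^ heightExponent K ℕ.* (B ℕ.* B) → HeightBound (heightExponent K) 1 N (af (r * r) y)
    fromLowestTerms u B 1≤B r²B²≡u² u²≤ = heightBound N (heightExponent K) (af (r * r) y)
      (subst (_≤ bound) (sym (0≤p⇒∣p∣≡p (0≤p² r))) (*-cancelʳ-≤-pos (ℕ→ℚ (B ℕ.* B)) {{B²>0}} (begin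
        r * r * ℕ→ℚ (B ℕ.* B)                      ≡⟨ r²B²≡u² ⟩
        ℕ→ℚ (u ℕ.* u)                              ≤⟨ ℕ→ℚ-mono-≤ u²≤ ⟩
        ℕ→ℚ (N ℕ.^ heightExponent K ℕ.* (B ℕ.* B)) ≡⟨ ℕ→ℚ-* (N ℕ.^ heightExponent K) (B ℕ.* B) ⟩
        bound * ℕ→ℚ (B ℕ.* B)                      ∎)))
      where
      B²>0 : Positive (ℕ→ℚ (B ℕ.* B))
      B²>0 = normalize-pos (B ℕ.* B) 1 {{_}} {{ℕ.>-nonZero (ℕ.*-mono-≤ 1≤B 1≤B)}}

  squareAbscissa-height : ∀ K → ABC¼ K → ∀ N x y r → 1 ℕ.≤ N → x ≢ 0ℚ → OnCurve N (af x y) → L (af x y) ℕ.≤ 1 → x ≡ r * r →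
    HeightBound (heightExponent K) 1 N (af x y)
  squareAbscissa-height K abc N _ y r 1≤N x≢0 on L≤1 refl = squarePoint-height K abc N r y 1≤N (λ { refl → x≢0 refl }) on L≤1

  curve-at-negative : ∀ n x → x * x * x - n * x ≡ - (- x * (- x * - x - n))
  curve-at-negative = RingSolver.solve-∀ ℚ-ring

  -- If w = |x| exceeded N ≥ 1, then w² > w > N and y² = -w(w² - N) < 0. The bound N in place of √N
  -- is enough, since the final exponent is at least 1.
  nonPositivePoint-bound : ∀ N x y → 1 ℕ.≤ N → OnCurve N (af x y) → x ≤ 0ℚ → ∣ x ∣ ≤ ℕ→ℚ N
  nonPositivePoint-bound N x y 1≤N on x≤0 = ≮⇒≥ λ n<∣x∣ → <-irrefl refl (begin-strict
    0ℚ                         ≤⟨ 0≤p² y ⟩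
    y * y                      ≡⟨ on ⟩
    x * x * x - n * x          ≡⟨ curve-at-negative n x ⟩
    - (- x * (- x * - x - n))  ≡⟨ cong (λ w → - (w * (w * w - n))) (sym ∣x∣≡-x) ⟩
    - (w * (w * w - n))        <⟨ neg-antimono-< (0<w[w²-n] n<∣x∣) ⟩
    0ℚ                         ∎)
    where
    open ≤-Reasoning
    n = ℕ→ℚ N
    w = ∣ x ∣
    ∣x∣≡-x : w ≡ - x
    ∣x∣≡-x = trans (sym (∣-p∣≡∣p∣ x)) (0≤p⇒∣p∣≡p (neg-antimono-≤ x≤0))
    1≤n : 1ℚ ≤ n
    1≤n = ℕ→ℚ-mono-≤ 1≤N
    0<w[w²-n] : n < w → 0ℚ < w * (w * w - n)
    0<w[w²-n] n<w = positive⁻¹ _ {{pos*pos⇒pos w {{w>0}} (w * w - n) {{positive 0<w²-n}}}}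
      where
      1<w : 1ℚ < w
      1<w = ≤-<-trans 1≤n n<w
      w>0 : Positive w
      w>0 = positive (<-trans (positive⁻¹ 1ℚ) 1<w)
      n<w² : n < w * w
      n<w² = begin-strict
        n      <⟨ n<w ⟩
        w      ≡⟨ *-identityˡ w ⟨
        1ℚ * w <⟨ *-monoˡ-<-pos w {{w>0}} 1<w ⟩
        w * w  ∎
      0<w²-n : 0ℚ < w * w - n
      0<w²-n = subst (_< w * w - n) (+-inverseʳ n) (+-monoˡ-< (- n) n<w²)

  negative*q≡square⇒q≤0 : ∀ p q t → p < 0ℚ → p * q ≡ t * t → q ≤ 0ℚ
  negative*q≡square⇒q≤0 p q t p<0 pq≡t² = ≮⇒≥ λ 0<q →
    <-irrefl refl (≤-<-trans (subst (0ℚ ≤_) (sym pq≡t²) (0≤p² t)) (negative⁻¹ _ {{neg*pos⇒neg p {{negative p<0}} q {{positive 0<q}}}}))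

  1≤heightExponent : ∀ K → 1 ℕ.≤ heightExponent K
  1≤heightExponent K = ℕ.≤-trans (ℕ.≤-trans (s≤s z≤n) (ℕ.m≤n+m 8 (K ℕ.* 8 ℕ.+ 35))) (ℕ.m≤m+n _ _)

  descent⇒height : ∀ K → ABC¼ K → ∀ N P Q → 1 ℕ.≤ N → xc P < 0ℚ → OnCurve N Q → SquareUpTo (descent N P) (descent N Q) →
    Q ≢ O → L Q ℕ.≤ 1 → HeightBound (heightExponent K) 1 N Q
  -- `xc O` is the default value 0, so the sign hypothesis excludes P = O.
  descent⇒height K abc N O Q 1≤N x<0 = ⊥-elim (<-irrefl refl x<0)
  descent⇒height K abc N (af x₁ y₁) O 1≤N x<0 on class Q≢O L≤1 = contradiction refl Q≢O
  descent⇒height K abc N (af x₁ y₁) (af x y) 1≤N x₁<0 on class Q≢O L≤1 = cases (x ≟ 0ℚ)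
    where
    compactComponent : x ≤ 0ℚ → HeightBound (heightExponent K) 1 N (af x y)
    compactComponent x≤0 = heightBound N (heightExponent K) (af x y) (≤-trans (nonPositivePoint-bound N x y 1≤N on x≤0)
      (ℕ→ℚ-mono-≤ (ℕ.≤-trans (ℕ.≤-reflexive (sym (ℕ.^-identityʳ N))) (ℕ.^-monoʳ-≤ N {{ℕ.>-nonZero 1≤N}} (1≤heightExponent K)))))
    cases : Dec (x ≡ 0ℚ) → HeightBound (heightExponent K) 1 N (af x y)
    -- At (0,0) the class is that of -N and carries no information on x; the height bound is
    -- immediate.
    cases (yes x≡0) = compactComponent (≤-reflexive x≡0)
    cases (no x≢0) = [ (λ (r , eq) → squareAbscissa-height K abc N x y r 1≤N x≢0 on L≤1 (trans (sym (descentAt-≢0 N x x≢0)) eq))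
                     , (λ (t , eq) → compactComponent (negative*q≡square⇒q≤0 x₁ x t x₁<0
                         (trans (sym (cong₂ _*_ (descentAt-≢0 N x₁ (<⇒≢ x₁<0)) (descentAt-≢0 N x x≢0))) eq))) ]′ class

  -- The class of the second generator.

  -- The abscissa 0 is a square, yet the class of (0,0) is -N, which need not be trivial. This point
  -- has order 2, so the relation 0 P + 2 (0,0) = O contradicts independence.
  ¬independent-origin : ∀ N P y → OnCurve N (af 0ℚ y) → ¬ Independent N P (af 0ℚ y)
  ¬independent-origin N P y on ind = twoTorsion y (p²≡0⇒p≡0 y (trans on (vanishes (ℕ→ℚ N)))) ind
    where
    vanishes : ∀ n → 0ℚ * 0ℚ * 0ℚ - n * 0ℚ ≡ 0ℚ
    vanishes n = trans (+-identityˡ _) (cong (-_) (*-zeroʳ n))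
    twoTorsion : ∀ y → y ≡ 0ℚ → ¬ Independent N P (af 0ℚ y)
    twoTorsion _ refl ind = contradiction (proj₂ (ind (ℤ.+ 0) (ℤ.+ 2) refl)) λ ()

  -- For Q = 2R the class is the square of that of R. A nonzero square abscissa is its own
  -- representative.
  isSquare-descent : ∀ N P Q → 1 ℕ.≤ N → OnCurve N Q → Independent N P Q → IsDouble N Q ⊎ (Q ≢ O × XSquare Q) →
    IsSquare (descent N Q)
  isSquare-descent N P _ 1≤N _ _ (inj₁ (R , onR , refl)) =
    cancelSquare (descent N R * descent N R) _ (λ eq → descent-nonzero N R 1≤N (p²≡0⇒p≡0 _ eq)) (descent N R , refl)
      (proj₂ (add-descent N R R 1≤N onR onR))
  isSquare-descent N P O _ _ _ (inj₂ (Q≢O , _)) = contradiction refl Q≢O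
  isSquare-descent N P (af x y) 1≤N on ind (inj₂ (_ , r , x≡r²)) = cases x on ind x≡r² (x ≟ 0ℚ)
    where
    cases : ∀ x → OnCurve N (af x y) → Independent N P (af x y) → x ≡ r * r → Dec (x ≡ 0ℚ) → IsSquare (descentAt N x)
    cases x on ind x≡r² (no x≢0)   = r , trans (descentAt-≢0 N x x≢0) x≡r²
    cases _ on ind x≡r² (yes refl) = ⊥-elim (¬independent-origin N P y on ind)

open import Data.Nat using (_≤_; s≤s; z≤n)
open import Data.Rational using (_<_; 0ℚ)
open Arithmetic using (heightExponent)
open Descent

theorem1p1 : ABC →
    (Σ ℕ λ p → Σ ℕ λ q → 1 ≤ p × 1 ≤ q ×
    ((N : ℕ) → 1 ≤ N → (Q₁ : Pt) → OnCurve N Q₁ → Q₁ ≢ O → NonTorsion N Q₁ → xc Q₁ < 0ℚ →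
    (n : ℤ) → mul N n Q₁ ≢ O → L (mul N n Q₁) ≤ 1 → HeightBound p q N (mul N n Q₁)))
    ×
    (Σ ℕ λ p → Σ ℕ λ q → 1 ≤ p × 1 ≤ q ×
    ((N : ℕ) → 1 ≤ N → (Q₁ Q₂ : Pt) → OnCurve N Q₁ → OnCurve N Q₂ →
    Q₁ ≢ O → NonTorsion N Q₁ → xc Q₁ < 0ℚ →
    Independent N Q₁ Q₂ → (IsDouble N Q₂ ⊎ (Q₂ ≢ O × XSquare Q₂)) →
    (Q : Pt) → InSpan N Q₁ Q₂ Q → Q ≢ O → L Q ≤ 1 → HeightBound p q N Q))
theorem1p1 abc =
  -- The values e = 1 and d = 4 mean ε = 1/4. K is fixed before N and the points, so the exponent is
  -- uniform in them.
  let K , _ , abcK = abc 1 4 (s≤s z≤n) (s≤s z≤n) in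
  (heightExponent K , 1 , 1≤heightExponent K , s≤s z≤n , λ N 1≤N Q₁ on₁ _ _ x₁<0 n →
    let on , class = integerMultiple-descent N Q₁ n 1≤N on₁
    in descent⇒height K abcK N Q₁ (mul N n Q₁) 1≤N x₁<0 on class) ,
  (heightExponent K , 1 , 1≤heightExponent K , s≤s z≤n , λ N 1≤N Q₁ Q₂ on₁ on₂ _ _ x₁<0 ind type Q span →
    let on , class = span-descent N Q₁ Q₂ Q 1≤N on₁ on₂ (isSquare-descent N Q₁ Q₂ 1≤N on₂ ind type) span
    in descent⇒height K abcK N Q₁ Q 1≤N x₁<0 on class)
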